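{- Let $C_4$ be the cycle on $4$ vertices. The set of all ordered multiplicity lists attained by matrices in $\mathcal{S}_L(C_4)$ is exactly $\{(1,1,1,1), (1,2,1)\}$.
   Context: For a finite simple graph $G$ on $n$ vertices, $\mathcal{S}_L(G)$ denotes the set of $n\times n$ real symmetric matrices $A=[a_{i,j}]$ such that $a_{i,j}<0$ if $\{i,j\}\in E(G)$, $a_{i,j}=0$ if $i\neq j$ and $\{i,j\}\notin E(G)$, and $a_{i,i}=-\sum_{k\neq i}a_{i,k}$ for all $i$. The ordered multiplicity list of $A\in\mathcal{S}_L(G)$ is $(m_1,\ldots,m_q)$, where $\lambda_1<\lambda_2<\cdots<\lambda_q$ are the distinct eigenvalues of $A$ in increasing order and $m_i$ is the multiplicity of $\lambda_i$. -}

module Defs where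

open import Algebra.Bundles using (CommutativeRing)
open import Data.Fin.Base as Fin using (Fin; toℕ)
open import Data.Fin.Properties using () renaming (_≟_ to _≟ᶠ_)
open import Data.List.Base using (List; length; lookup)
open import Data.Nat.Base as ℕ using (ℕ)
open import Data.Nat.DivMod using (_%_)
open import Data.Product.Base using (∃; ∃-syntax; _×_; _,_)
open import Data.Sum.Base using (_⊎_; inj₁; inj₂; swap)
open import Data.Vec.Functional using (Vector)
open import Level using (0ℓ)
open import Relation.Binary.Core using (Rel)
open import Relation.Binary.PropositionalEquality using (_≡_; _≢_)
open import Relation.Binary.Structures using (IsStrictTotalOrder)
open import Relation.Nullary.Decidable using (does)
open import Relation.Nullary.Negation using (¬_)
open import Relation.Unary using (Pred; _∈_)
open import Data.Bool.Base using (if_then_else_)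
import Algebra.Definitions.RawMonoid as RawMonoid

-- The real numbers, given by the axioms of a Dedekind-complete ordered field,
-- which determine them up to unique isomorphism. The order is decidable and
-- every predicate is admitted in `complete`, so these are the classical reals.
-- Equality is the setoid equality _≈_.
record Reals : Set₁ where
  field
    commutativeRing : CommutativeRing 0ℓ 0ℓ

  open CommutativeRing commutativeRing public

  infix 4 _<_ _≤_

  field
    _<_                : Rel Carrier 0ℓ
    isStrictTotalOrder : IsStrictTotalOrder _≈_ _<_
    0≉1                : ¬ 0# ≈ 1#
    inverse            : ∀ x → ¬ x ≈ 0# → ∃[ y ] x * y ≈ 1#
    +-monoˡ-<          : ∀ {x y} z → x < y → x + z < y + z
    *-pos              : ∀ {x y} → 0# < x → 0# < y → 0# < x * y

  _≤_ : Rel Carrier 0ℓ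
  x ≤ y = ¬ y < x

  IsUpperBound : Pred Carrier 0ℓ → Pred Carrier 0ℓ
  IsUpperBound P u = ∀ x → x ∈ P → x ≤ u

  IsSupremum : Pred Carrier 0ℓ → Pred Carrier 0ℓ
  IsSupremum P s = IsUpperBound P s × (∀ u → IsUpperBound P u → s ≤ u)

  field
    complete : ∀ (P : Pred Carrier 0ℓ) → ∃ P → ∃ (IsUpperBound P) → ∃ (IsSupremum P)

  open RawMonoid +-rawMonoid public using (sum)

record SimpleGraph (n : ℕ) : Set₁ where
  field
    Adj    : Rel (Fin n) 0ℓ
    sym    : ∀ {i j} → Adj i j → Adj j i
    irrefl : ∀ {i} → ¬ Adj i i

C₄ : SimpleGraph 4
C₄ = record { Adj = Adj ; sym = swap ; irrefl = λ {i} → irrefl i }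
  where
  Next : Rel (Fin 4) 0ℓ
  Next i j = toℕ j ≡ ℕ.suc (toℕ i) % 4

  Adj : Rel (Fin 4) 0ℓ
  Adj i j = Next i j ⊎ Next j i

  irrefl : ∀ i → ¬ Adj i i
  irrefl Fin.zero                               (inj₁ ())
  irrefl Fin.zero                               (inj₂ ())
  irrefl (Fin.suc Fin.zero)                     (inj₁ ())
  irrefl (Fin.suc Fin.zero)                     (inj₂ ())
  irrefl (Fin.suc (Fin.suc Fin.zero))           (inj₁ ())
  irrefl (Fin.suc (Fin.suc Fin.zero))           (inj₂ ())
  irrefl (Fin.suc (Fin.suc (Fin.suc Fin.zero))) (inj₁ ())
  irrefl (Fin.suc (Fin.suc (Fin.suc Fin.zero))) (inj₂ ())

module _ (ℝ : Reals) where
  open Reals ℝ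

  Matrix : ℕ → Set
  Matrix n = Fin n → Fin n → Carrier

  record 𝒮ᴸ {n} (G : SimpleGraph n) (A : Matrix n) : Set where
    open SimpleGraph G using (Adj)
    field
      symmetric : ∀ i j → A i j ≈ A j i
      edge      : ∀ i j → Adj i j → A i j < 0#
      nonEdge   : ∀ i j → i ≢ j → ¬ Adj i j → A i j ≈ 0#
      diagonal  : ∀ i → A i i ≈ - sum (λ k → if does (k ≟ᶠ i) then 0# else A i k)

  infix 4 _≋_

  _≋_ : ∀ {n} → Rel (Vector Carrier n) 0ℓ
  v ≋ w = ∀ i → v i ≈ w i

  𝟎 : ∀ {n} → Vector Carrier n
  𝟎 _ = 0#

  Eigenspace : ∀ {n} → Matrix n → Carrier → Pred (Vector Carrier n) 0ℓ
  Eigenspace A μ v = (λ i → sum (λ j → A i j * v j)) ≋ (λ i → μ * v i)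

  IsEigenvalue : ∀ {n} → Matrix n → Pred Carrier 0ℓ
  IsEigenvalue A μ = ∃[ v ] v ∈ Eigenspace A μ × ¬ v ≋ 𝟎

  linComb : ∀ {n d} → Vector Carrier d → Vector (Vector Carrier n) d → Vector Carrier n
  linComb c b i = sum (λ k → c k * b k i)

  record IsBasis {n d} (V : Pred (Vector Carrier n) 0ℓ)
                 (b : Vector (Vector Carrier n) d) : Set where
    field
      members     : ∀ k → b k ∈ V
      independent : ∀ c → linComb c b ≋ 𝟎 → c ≋ 𝟎
      spanning    : ∀ v → v ∈ V → ∃[ c ] v ≋ linComb c b

  HasDimension : ∀ {n} → Pred (Vector Carrier n) 0ℓ → ℕ → Set
  HasDimension {n} V d = ∃[ b ] IsBasis {n} {d} V b

  -- The multiplicity of an eigenvalue is the dimension of its eigenspace; for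
  -- a symmetric real matrix this is also its algebraic multiplicity.
  HasMultiplicity : ∀ {n} → Matrix n → Carrier → ℕ → Set
  HasMultiplicity A μ m = HasDimension (Eigenspace A μ) m

  record IsOrderedMultiplicityList {n} (A : Matrix n) (ms : List ℕ) : Set where
    field
      eigenvalue     : Fin (length ms) → Carrier
      increasing     : ∀ i j → i Fin.< j → eigenvalue i < eigenvalue j
      isEigenvalue   : ∀ i → IsEigenvalue A (eigenvalue i)
      exhaustive     : ∀ μ → IsEigenvalue A μ → ∃[ i ] μ ≈ eigenvalue i
      multiplicities : ∀ i → HasMultiplicity A (eigenvalue i) (lookup ms i)

{-# OPTIONS --safe #-}
-- In the basis of Hadamard vectors, which are the characters of the Klein
-- four-group, a weighted Laplacian of C₄ with edge weights a, b, c, d becomes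
-- the direct sum of 0 and the arrowhead matrix with rows (P, 0, y), (0, Q, z),
-- (y, z, P + Q), where P = b + d, Q = a + c, y = d - b, z = a - c. Hence y² < P²
-- and z² < Q², and the signs of the characteristic cubic χ at 0, P, Q and
-- 2 (P + Q) separate its roots: by the intermediate value theorem they are
-- positive and distinct, unless y = 0 and z² = Q (Q - P), or symmetrically with
-- (P, y) and (Q, z) exchanged. Simple roots have one-dimensional eigenspaces,
-- because χ′ is the sum of the principal 2 × 2 minors. In the exceptional case
-- the nonzero eigenvalues are P, with a two-dimensional eigenspace, and 2 Q > P.
module Submission where

open import Defs
open import Algebra.Bundles using (CommutativeRing)
open import Algebra.Solver.Ring.AlmostCommutativeRing
  using (_-Raw-AlmostCommutative⟶_; fromCommutativeRing)
open import Data.Bool.Base using (if_then_else_)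
open import Data.Fin.Base as Fin using (Fin; zero; suc; toℕ; punchIn; punchOut)
import Data.Fin.Induction as Fin
open import Data.Fin.Patterns using (0F; 1F; 2F; 3F)
import Data.Fin.Properties as Fin
open import Data.Integer.Base as ℤ using (ℤ; +_; -[1+_])
import Data.Integer.Properties as ℤ
open import Data.List.Base using (List; _∷_; []; length; lookup)
open import Data.Maybe.Base using (Maybe; map)
open import Data.Nat.Base as ℕ using (ℕ; zero; suc; s≤s)
import Data.Nat.Properties as ℕ
open import Data.Product.Base using (∃; ∃-syntax; _×_; _,_; proj₁; proj₂)
open import Data.Sum.Base as Sum using (_⊎_; inj₁; inj₂)
open import Data.Vec.Functional using (Vector) renaming (_∷_ to _∷ᵛ_; [] to []ᵛ)
open import Function.Bundles using (_⇔_; mk⇔)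
open import Level using (0ℓ)
open import Relation.Binary.Consequences using (dec⇒weaklyDec)
open import Relation.Binary.Definitions using (tri<; tri≈; tri>)
open import Relation.Binary.PropositionalEquality as ≡ using (_≡_; _≢_)
open import Relation.Binary.Structures using (IsStrictTotalOrder)
open import Relation.Nullary.Decidable using (yes; no; does; ¬?; decidable-stable)
open import Relation.Nullary.Negation using (¬_; contradiction)
open import Relation.Unary using (Pred; _∈_)

-- The obstacle is that the roots of χ have no convenient closed form, so they are located by signs.
-- Since χ(P) = y² (Q - P) and χ(Q) = - z² (Q - P), the signs are strict unless y = 0, z = 0 or P =
-- Q. In each of these cases P or Q is itself a root, and the quotient of χ by it is a quadratic (x
-- - m) (x - s) - w with s = P + Q. The larger root of the quadratic is at least s, which exceeds
-- the known root, so only the smaller one can coincide with it: a repeated eigenvalue is never the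
-- largest. The eigenvalue 0 stays simple because the product of the other three is positive. Having
-- a given multiplicity list is a relation, so producing one list for each matrix does not by itself
-- exclude others. Uniqueness of the list is therefore proved for arbitrary matrices, from the
-- invariance of dimension.

-- The library's ring solvers need a decidable zero test on coefficients, which
-- an abstract ring lacks; here the coefficients are the integers instead.
module IntegerCoefficients (R : CommutativeRing 0ℓ 0ℓ) where
  open CommutativeRing R
  open import Algebra.Properties.Ring ring
  open import Algebra.Properties.AbelianGroup +-abelianGroup using (⁻¹-∙-comm)
  open import Algebra.Properties.Semiring.Mult.TCOptimised semiring
    using (×1-homo-*; ×-homo-+; 1+×) renaming (_×_ to _·_)
  open import Relation.Binary.Reasoning.Setoid setoid

  fromℤ : ℤ → Carrier
  fromℤ (+ n)      = n · 1#
  fromℤ (-[1+ n ]) = - (suc n · 1#)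

  cancel-1+ : ∀ x y → (1# + x) + - (1# + y) ≈ x + - y
  cancel-1+ x y = begin
    (1# + x) + - (1# + y)     ≈⟨ +-congˡ (⁻¹-∙-comm 1# y) ⟨
    (1# + x) + (- 1# + - y)   ≈⟨ +-congʳ (+-comm 1# x) ⟩
    (x + 1#) + (- 1# + - y)   ≈⟨ +-assoc x 1# _ ⟩
    x + (1# + (- 1# + - y))   ≈⟨ +-congˡ (+-assoc 1# (- 1#) (- y)) ⟨
    x + ((1# + - 1#) + - y)   ≈⟨ +-congˡ (+-congʳ (-‿inverseʳ 1#)) ⟩
    x + (0# + - y)            ≈⟨ +-congˡ (+-identityˡ (- y)) ⟩
    x + - y                   ∎

  -- Recursion on both numbers at once replaces the comparison by which `⊖` is computed.
  ⊖-homo : ∀ m n → fromℤ (m ℤ.⊖ n) ≈ m · 1# + - (n · 1#)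
  ⊖-homo zero    zero    = sym (-‿inverseʳ 0#)
  ⊖-homo zero    (suc n) = sym (+-identityˡ _)
  ⊖-homo (suc m) zero    = sym (trans (+-congˡ -0#≈0#) (+-identityʳ _))
  ⊖-homo (suc m) (suc n) = begin
    fromℤ (suc m ℤ.⊖ suc n)              ≡⟨ ≡.cong fromℤ (ℤ.[1+m]⊖[1+n]≡m⊖n m n) ⟩
    fromℤ (m ℤ.⊖ n)                      ≈⟨ ⊖-homo m n ⟩
    m · 1# + - (n · 1#)                  ≈⟨ cancel-1+ _ _ ⟨
    (1# + m · 1#) + - (1# + n · 1#)      ≈⟨ +-cong (1+× m 1#) (-‿cong (1+× n 1#)) ⟨
    suc m · 1# + - (suc n · 1#)          ∎

  +-homo : ∀ i j → fromℤ (i ℤ.+ j) ≈ fromℤ i + fromℤ j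
  +-homo (+ m)      (+ n)      = ×-homo-+ 1# m n
  +-homo (+ m)      (-[1+ n ]) = ⊖-homo m (suc n)
  +-homo (-[1+ m ]) (+ n)      = trans (⊖-homo n (suc m)) (+-comm _ _)
  +-homo (-[1+ m ]) (-[1+ n ]) = begin
    - (suc (suc (m ℕ.+ n)) · 1#)           ≡⟨ ≡.cong (λ k → - (k · 1#)) (≡.cong suc (ℕ.+-suc m n)) ⟨
    - ((suc m ℕ.+ suc n) · 1#)             ≈⟨ -‿cong (×-homo-+ 1# (suc m) (suc n)) ⟩
    - (suc m · 1# + suc n · 1#)            ≈⟨ ⁻¹-∙-comm _ _ ⟨
    - (suc m · 1#) + - (suc n · 1#)        ∎

  -‿homo : ∀ i → fromℤ (ℤ.- i) ≈ - fromℤ i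
  -‿homo (+ zero)   = sym -0#≈0#
  -‿homo (+ suc n)  = refl
  -‿homo (-[1+ n ]) = sym (-‿involutive _)

  *-homo⁺ : ∀ m j → fromℤ (+ m ℤ.* j) ≈ fromℤ (+ m) * fromℤ j
  *-homo⁺ m (+ n) = begin
    fromℤ (+ m ℤ.* + n)   ≡⟨ ≡.cong fromℤ (ℤ.pos-* m n) ⟨
    (m ℕ.* n) · 1#        ≈⟨ ×1-homo-* m n ⟩
    m · 1# * n · 1#       ∎
  *-homo⁺ m (-[1+ n ]) = begin
    fromℤ (+ m ℤ.* (ℤ.- + suc n))   ≡⟨ ≡.cong fromℤ (ℤ.neg-distribʳ-* (+ m) (+ suc n)) ⟨
    fromℤ (ℤ.- (+ m ℤ.* + suc n))   ≈⟨ -‿homo (+ m ℤ.* + suc n) ⟩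
    - fromℤ (+ m ℤ.* + suc n)       ≈⟨ -‿cong (*-homo⁺ m (+ suc n)) ⟩
    - (m · 1# * suc n · 1#)         ≈⟨ -‿distribʳ-* _ _ ⟩
    m · 1# * - (suc n · 1#)         ∎

  *-homo : ∀ i j → fromℤ (i ℤ.* j) ≈ fromℤ i * fromℤ j
  *-homo (+ m)      j = *-homo⁺ m j
  *-homo (-[1+ m ]) j = begin
    fromℤ ((ℤ.- + suc m) ℤ.* j)   ≡⟨ ≡.cong fromℤ (ℤ.neg-distribˡ-* (+ suc m) j) ⟨
    fromℤ (ℤ.- (+ suc m ℤ.* j))   ≈⟨ -‿homo (+ suc m ℤ.* j) ⟩
    - fromℤ (+ suc m ℤ.* j)       ≈⟨ -‿cong (*-homo⁺ (suc m) j) ⟩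
    - (suc m · 1# * fromℤ j)      ≈⟨ -‿distribˡ-* _ _ ⟩
    - (suc m · 1#) * fromℤ j      ∎

  morphism : ℤ.+-*-rawRing -Raw-AlmostCommutative⟶ fromCommutativeRing R
  morphism = record
    { ⟦_⟧    = fromℤ
    ; +-homo = +-homo
    ; *-homo = *-homo
    ; -‿homo = -‿homo
    ; 0-homo = refl
    ; 1-homo = refl
    }

  coeff≟ : ∀ i j → Maybe (fromℤ i ≈ fromℤ j)
  coeff≟ i j = map (λ { ≡.refl → refl }) (dec⇒weaklyDec ℤ._≟_ i j)

  open import Algebra.Solver.Ring ℤ.+-*-rawRing (fromCommutativeRing R) morphism coeff≟ public

-- Ordered field arithmetic and the intermediate value theorem

module OrderedField (ℝ : Reals) where
  open Reals ℝ
  open IsStrictTotalOrder isStrictTotalOrder public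
    using (compare; _≟_) renaming (trans to <-trans; irrefl to <-irrefl)
  open IsStrictTotalOrder isStrictTotalOrder using (<-respʳ-≈; <-respˡ-≈)
  open IntegerCoefficients commutativeRing using (solve; con; _:=_; _:+_; _:*_; :-_; _:-_)

  0<-resp : ∀ {x y} → x ≈ y → 0# < x → 0# < y
  0<-resp = <-respʳ-≈

  0≤-resp : ∀ {x y} → x ≈ y → 0# ≤ x → 0# ≤ y
  0≤-resp x≈y 0≤x y<0 = 0≤x (<-respˡ-≈ (sym x≈y) y<0)

  <⇒0<- : ∀ {x y} → x < y → 0# < y - x
  <⇒0<- {x} x<y = <-respˡ-≈ (-‿inverseʳ x) (+-monoˡ-< (- x) x<y)

  0<-⇒< : ∀ {x y} → 0# < y - x → x < y
  0<-⇒< {x} {y} 0<y-x = <-respˡ-≈ (+-identityˡ x)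
    (<-respʳ-≈ (solve 2 (λ x y → (y :- x) :+ x := y) refl x y) (+-monoˡ-< x 0<y-x))

  ≤⇒0≤- : ∀ {x y} → x ≤ y → 0# ≤ y - x
  ≤⇒0≤- {x} {y} x≤y y-x<0 = x≤y (<-respˡ-≈ (solve 2 (λ x y → (y :- x) :+ x := y) refl x y)
    (<-respʳ-≈ (+-identityˡ x) (+-monoˡ-< x y-x<0)))

  0≤-⇒≤ : ∀ {x y} → 0# ≤ y - x → x ≤ y
  0≤-⇒≤ {x} 0≤y-x y<x = 0≤y-x (<-respʳ-≈ (-‿inverseʳ x) (+-monoˡ-< (- x) y<x))

  <⇒≤ : ∀ {x y} → x < y → x ≤ y
  <⇒≤ x<y y<x = <-irrefl refl (<-trans x<y y<x)

  <⇒≉ : ∀ {x y} → x < y → ¬ x ≈ y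
  <⇒≉ x<y x≈y = <-irrefl x≈y x<y

  ≈⇒≤ : ∀ {x y} → x ≈ y → x ≤ y
  ≈⇒≤ x≈y y<x = <-irrefl (sym x≈y) y<x

  ≤⇒<⊎≈ : ∀ {x y} → x ≤ y → x < y ⊎ x ≈ y
  ≤⇒<⊎≈ {x} {y} x≤y with compare x y
  ... | tri< x<y _ _ = inj₁ x<y
  ... | tri≈ _ x≈y _ = inj₂ x≈y
  ... | tri> _ _ y<x = contradiction y<x x≤y

  ≤∧≉⇒< : ∀ {x y} → x ≤ y → ¬ x ≈ y → x < y
  ≤∧≉⇒< x≤y x≉y with ≤⇒<⊎≈ x≤y
  ... | inj₁ x<y = x<y
  ... | inj₂ x≈y = contradiction x≈y x≉y

  +-pos : ∀ {x y} → 0# < x → 0# < y → 0# < x + y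
  +-pos {x} {y} 0<x 0<y = <-trans 0<y (<-respˡ-≈ (+-identityˡ y) (+-monoˡ-< y 0<x))

  +-pos-nonNeg : ∀ {x y} → 0# < x → 0# ≤ y → 0# < x + y
  +-pos-nonNeg 0<x 0≤y with ≤⇒<⊎≈ 0≤y
  ... | inj₁ 0<y = +-pos 0<x 0<y
  ... | inj₂ 0≈y = 0<-resp (trans (sym (+-identityʳ _)) (+-congˡ 0≈y)) 0<x

  +-nonNeg : ∀ {x y} → 0# ≤ x → 0# ≤ y → 0# ≤ x + y
  +-nonNeg 0≤x 0≤y with ≤⇒<⊎≈ 0≤x
  ... | inj₁ 0<x = <⇒≤ (+-pos-nonNeg 0<x 0≤y)
  ... | inj₂ 0≈x = 0≤-resp (trans (sym (+-identityˡ _)) (+-congʳ 0≈x)) 0≤y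

  *-nonNeg : ∀ {x y} → 0# ≤ x → 0# ≤ y → 0# ≤ x * y
  *-nonNeg 0≤x 0≤y with ≤⇒<⊎≈ 0≤x | ≤⇒<⊎≈ 0≤y
  ... | inj₁ 0<x | inj₁ 0<y = <⇒≤ (*-pos 0<x 0<y)
  ... | inj₁ 0<x | inj₂ 0≈y = ≈⇒≤ (trans (sym (zeroʳ _)) (*-congˡ 0≈y))
  ... | inj₂ 0≈x | _        = ≈⇒≤ (trans (sym (zeroˡ _)) (*-congʳ 0≈x))

  ≤-trans : ∀ {x y z} → x ≤ y → y ≤ z → x ≤ z
  ≤-trans {x} {y} {z} x≤y y≤z = 0≤-⇒≤ (0≤-resp
    (solve 3 (λ x y z → (y :- x) :+ (z :- y) := z :- x) refl x y z)
    (+-nonNeg (≤⇒0≤- x≤y) (≤⇒0≤- y≤z)))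

  <-≤-trans : ∀ {x y z} → x < y → y ≤ z → x < z
  <-≤-trans {x} {y} {z} x<y y≤z = 0<-⇒< (0<-resp
    (solve 3 (λ x y z → (y :- x) :+ (z :- y) := z :- x) refl x y z)
    (+-pos-nonNeg (<⇒0<- x<y) (≤⇒0≤- y≤z)))

  ≤-<-trans : ∀ {x y z} → x ≤ y → y < z → x < z
  ≤-<-trans {x} {y} {z} x≤y y<z = 0<-⇒< (0<-resp
    (solve 3 (λ x y z → (z :- y) :+ (y :- x) := z :- x) refl x y z)
    (+-pos-nonNeg (<⇒0<- y<z) (≤⇒0≤- x≤y)))

  0≤-neg : ∀ {x} → x ≤ 0# → 0# ≤ - x
  0≤-neg x≤0 = 0≤-resp (+-identityˡ _) (≤⇒0≤- x≤0)

  0<-neg : ∀ {x} → x < 0# → 0# < - x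
  0<-neg x<0 = 0<-resp (+-identityˡ _) (<⇒0<- x<0)

  neg<0 : ∀ {x} → 0# < x → - x < 0#
  neg<0 {x} 0<x = 0<-⇒< (0<-resp (solve 1 (λ x → x := con (+ 0) :- (:- x)) refl x) 0<x)

  sq-pos : ∀ {x} → ¬ x ≈ 0# → 0# < x * x
  sq-pos {x} x≉0 with compare x 0#
  ... | tri< x<0 _ _ = 0<-resp (solve 1 (λ x → (:- x) :* (:- x) := x :* x) refl x)
                         (*-pos (0<-neg x<0) (0<-neg x<0))
  ... | tri≈ _ x≈0 _ = contradiction x≈0 x≉0
  ... | tri> _ _ 0<x = *-pos 0<x 0<x

  sq-nonNeg : ∀ x → 0# ≤ x * x
  sq-nonNeg x with x ≟ 0#
  ... | yes x≈0 = ≈⇒≤ (sym (trans (*-congˡ x≈0) (zeroʳ x)))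
  ... | no  x≉0 = <⇒≤ (sq-pos x≉0)

  0<1 : 0# < 1#
  0<1 = 0<-resp (*-identityˡ 1#) (sq-pos (λ 1≈0 → 0≉1 (sym 1≈0)))

  *-cancel-0 : ∀ {x y} → ¬ x ≈ 0# → x * y ≈ 0# → y ≈ 0#
  *-cancel-0 {x} {y} x≉0 xy≈0 with inverse x x≉0
  ... | x⁻¹ , xx⁻¹≈1 = begin
    y               ≈⟨ *-identityˡ y ⟨
    1# * y          ≈⟨ *-congʳ xx⁻¹≈1 ⟨
    x * x⁻¹ * y     ≈⟨ solve 3 (λ x x⁻¹ y → x :* x⁻¹ :* y := x⁻¹ :* (x :* y)) refl x x⁻¹ y ⟩
    x⁻¹ * (x * y)   ≈⟨ *-congˡ xy≈0 ⟩
    x⁻¹ * 0#        ≈⟨ zeroʳ x⁻¹ ⟩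
    0#              ∎
    where open import Relation.Binary.Reasoning.Setoid setoid

  *-zero-⊎ : ∀ {x y} → x * y ≈ 0# → x ≈ 0# ⊎ y ≈ 0#
  *-zero-⊎ {x} xy≈0 with x ≟ 0#
  ... | yes x≈0 = inj₁ x≈0
  ... | no  x≉0 = inj₂ (*-cancel-0 x≉0 xy≈0)

  *-≉0 : ∀ {x y} → ¬ x ≈ 0# → ¬ y ≈ 0# → ¬ x * y ≈ 0#
  *-≉0 x≉0 y≉0 xy≈0 = y≉0 (*-cancel-0 x≉0 xy≈0)

  -≈0⇒≈ : ∀ {x y} → x - y ≈ 0# → x ≈ y
  -≈0⇒≈ {x} {y} x-y≈0 = trans (solve 2 (λ x y → x := (x :- y) :+ y) refl x y)
    (trans (+-congʳ x-y≈0) (+-identityˡ y))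

  ≈⇒-≈0 : ∀ {x y} → x ≈ y → x - y ≈ 0#
  ≈⇒-≈0 {x} {y} x≈y = trans (+-congʳ x≈y) (-‿inverseʳ y)

  -- For negative `y` the product `x * (- y)` would be nonnegative, and adding it to the positive
  -- `x * y` would give 0 > 0. A weak bound on `x` is what the applications have: there `x` is often
  -- the distance from a root known only up to ≤.
  *-pos-cancelˡ : ∀ {x y} → 0# ≤ x → 0# < x * y → 0# < y
  *-pos-cancelˡ {x} {y} 0≤x 0<xy with compare 0# y
  ... | tri< 0<y _ _ = 0<y
  ... | tri≈ _ 0≈y _ = contradiction (trans (sym (zeroʳ x)) (*-congˡ 0≈y)) (<⇒≉ 0<xy)
  ... | tri> _ _ y<0 = contradiction
    (0<-resp (solve 2 (λ x y → x :* y :+ x :* (:- y) := con (+ 0)) refl x y)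
      (+-pos-nonNeg 0<xy (*-nonNeg 0≤x (<⇒≤ (0<-neg y<0)))))
    (<-irrefl refl)

  0<x⁻¹ : ∀ {x y} → 0# < x → x * y ≈ 1# → 0# < y
  0<x⁻¹ 0<x xy≈1 = *-pos-cancelˡ (<⇒≤ 0<x) (0<-resp (sym xy≈1) 0<1)

  -- A one-sided Lipschitz bound suffices: it prevents f from jumping up.
  ivt : ∀ (f : Carrier → Carrier) → (∀ {x y} → x ≈ y → f x ≈ f y) →
        ∀ {l h K} → l ≤ h → 0# < K →
        (∀ {x y} → l ≤ x → x ≤ y → y ≤ h → 0# ≤ K * (y - x) - (f y - f x)) →
        f l ≤ 0# → 0# ≤ f h →
        ∃[ r ] l ≤ r × r ≤ h × f r ≈ 0#
  ivt f f-cong {l} {h} {K} l≤h 0<K lip fl≤0 0≤fh = root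
    where
    -- The root will be the supremum of the points of [l, h] where `f` is nonpositive.
    P : Carrier → Set
    P x = l ≤ x × x ≤ h × f x ≤ 0#

    sup = complete P (l , ≈⇒≤ refl , l≤h , fl≤0) (h , λ _ (_ , x≤h , _) → x≤h)

    s = proj₁ sup
    s-upper = proj₁ (proj₂ sup)
    s-least = proj₂ (proj₂ sup)

    l≤s : l ≤ s
    l≤s = s-upper l (≈⇒≤ refl , l≤h , fl≤0)

    s≤h : s ≤ h
    s≤h = s-least h (λ _ (_ , x≤h , _) → x≤h)

    K⁻¹ = proj₁ (inverse K (λ K≈0 → <⇒≉ 0<K (sym K≈0)))

    KK⁻¹≈1 : K * K⁻¹ ≈ 1#
    KK⁻¹≈1 = proj₂ (inverse K (λ K≈0 → <⇒≉ 0<K (sym K≈0)))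

    0<K⁻¹ : 0# < K⁻¹
    0<K⁻¹ = 0<x⁻¹ 0<K KK⁻¹≈1

    K[K⁻¹x]≈x : ∀ x → K * (K⁻¹ * x) ≈ x
    K[K⁻¹x]≈x x = trans (sym (*-assoc K K⁻¹ x)) (trans (*-congʳ KK⁻¹≈1) (*-identityˡ x))

    -- The Lipschitz bound gives f (s + δ) ≤ f s + K δ ≤ 0, which puts s + δ into `P`, above its
    -- supremum.
    not-above : ∀ δ → 0# < δ → 0# ≤ h - s - δ → ¬ 0# ≤ - f s - K * δ
    not-above δ 0<δ δ≤h-s Kδ≤-fs = s-upper (s + δ) (l≤x , x≤h , fx≤0) s<x
      where
      s<x : s < s + δ
      s<x = 0<-⇒< (0<-resp (solve 2 (λ s δ → δ := (s :+ δ) :- s) refl s δ) 0<δ)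
      l≤x = ≤-trans l≤s (<⇒≤ s<x)
      x≤h : s + δ ≤ h
      x≤h = 0≤-⇒≤ (0≤-resp (solve 3 (λ s δ h → h :- s :- δ := h :- (s :+ δ)) refl s δ h) δ≤h-s)
      fx≤0 : f (s + δ) ≤ 0#
      fx≤0 = 0≤-⇒≤ (0≤-resp
        (solve 5 (λ K s δ a b → (K :* ((s :+ δ) :- s) :- (a :- b)) :+ (:- b :- K :* δ) := con (+ 0) :- a)
          refl K s δ (f (s + δ)) (f s))
        (+-nonNeg (lip l≤s (<⇒≤ s<x) x≤h) Kδ≤-fs))

    fs≮0 : ¬ f s < 0#
    -- The step to the right is the smaller of h - s and - f s / K: it must neither leave the
    -- interval nor let `f` become positive.
    fs≮0 fs<0 with compare (h - s) (K⁻¹ * - f s)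
    ... | tri< h-s<δ _ _ = not-above (h - s) (<⇒0<- s<h)
            (≈⇒≤ (sym (-‿inverseʳ (h - s))))
            (0≤-resp (trans (solve 3 (λ K a b → K :* (a :- b) := K :* a :- K :* b) refl K (K⁻¹ * - f s) (h - s))
                       (+-congʳ (K[K⁻¹x]≈x (- f s))))
              (<⇒≤ (*-pos 0<K (<⇒0<- h-s<δ))))
      where
      s<h : s < h
      s<h = ≤∧≉⇒< s≤h (λ s≈h → 0≤fh (<-respˡ-≈ (f-cong s≈h) fs<0))
    ... | tri≈ _ h-s≈δ _ = not-above (K⁻¹ * - f s) (*-pos 0<K⁻¹ (0<-neg fs<0))
            (≈⇒≤ (sym (≈⇒-≈0 h-s≈δ))) (≈⇒≤ (sym (≈⇒-≈0 (sym (K[K⁻¹x]≈x (- f s))))))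
    ... | tri> _ _ δ<h-s = not-above (K⁻¹ * - f s) (*-pos 0<K⁻¹ (0<-neg fs<0))
            (<⇒≤ (<⇒0<- δ<h-s)) (≈⇒≤ (sym (≈⇒-≈0 (sym (K[K⁻¹x]≈x (- f s))))))

    0≮fs : ¬ 0# < f s
    0≮fs 0<fs = s-least u u-upper u<s
      where
      -- Between s - f s / K and s the function is still positive, so s - δ is a smaller upper bound
      -- of `P`.
      δ = K⁻¹ * f s
      u = s - δ
      u<s : u < s
      u<s = 0<-⇒< (0<-resp (solve 2 (λ s δ → δ := s :- (s :- δ)) refl s δ) (*-pos 0<K⁻¹ 0<fs))
      u-upper : ∀ x → P x → x ≤ u
      u-upper x x∈P@(l≤x , x≤h , fx≤0) u<x = <-irrefl refl (0<-resp
        (trans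
          (solve 6 (λ K s δ x a b → (K :* (x :- (s :- δ)) :+ (:- b)) :+ (K :* (s :- x) :- (a :- b))
                       := K :* δ :- a)
            refl K s δ x (f s) (f x))
          (≈⇒-≈0 (K[K⁻¹x]≈x (f s))))
        (+-pos-nonNeg (+-pos-nonNeg (*-pos 0<K (<⇒0<- u<x)) (0≤-neg fx≤0))
          (lip l≤x (s-upper x x∈P) s≤h)))

    root : ∃[ r ] l ≤ r × r ≤ h × f r ≈ 0#
    root with compare (f s) 0#
    ... | tri< fs<0 _ _ = contradiction fs<0 fs≮0
    ... | tri≈ _ fs≈0 _ = s , l≤s , s≤h , fs≈0
    ... | tri> _ _ 0<fs = contradiction 0<fs 0≮fs

-- Finite lists and increasing maps of indices

-- Indices are matched through `toℕ` because the two index types differ until the lengths are known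
-- to agree. The second hypothesis keeps `ys` from being longer than `xs`.
lookup-ext : ∀ {A : Set} (xs ys : List A) →
  (∀ i → ∃[ j ] toℕ i ≡ toℕ j × lookup xs i ≡ lookup ys j) →
  (∀ (j : Fin (length ys)) → ∃[ i ] toℕ j ≡ toℕ {length xs} i) → xs ≡ ys
lookup-ext []       []       _ _ = ≡.refl
lookup-ext []       (y ∷ ys) _ g with () ← proj₁ (g zero)
lookup-ext (x ∷ xs) []       f _ with () ← proj₁ (f zero)
lookup-ext (x ∷ xs) (y ∷ ys) f g with f zero
... | zero , _ , x≡y = ≡.cong₂ _∷_ x≡y (lookup-ext xs ys f′ g′)
  where
  f′ : ∀ i → ∃[ j ] toℕ i ≡ toℕ j × lookup xs i ≡ lookup ys j
  f′ i with f (suc i)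
  ... | suc j , i≡j , eq = j , ℕ.suc-injective i≡j , eq
  g′ : ∀ (j : Fin (length ys)) → ∃[ i ] toℕ j ≡ toℕ {length xs} i
  g′ j with g (suc j)
  ... | suc i , j≡i = i , ℕ.suc-injective j≡i

-- Each step to the next index raises the value by at least one. Applied to two mutually inverse
-- maps, this forces both to preserve `toℕ`.
mono-<⇒i≤f[i] : ∀ {m n} (f : Fin m → Fin n) → (∀ {i j} → i Fin.< j → f i Fin.< f j) →
  ∀ i → i Fin.≤ f i
mono-<⇒i≤f[i] {suc m} f f-mono = Fin.<-weakInduction (λ i → i Fin.≤ f i) ℕ.z≤n
  (λ i i≤fi → ℕ.≤-<-trans (ℕ.≤-trans (ℕ.≤-reflexive (≡.sym (Fin.toℕ-inject₁ i))) i≤fi)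
    (f-mono (s≤s (ℕ.≤-reflexive (Fin.toℕ-inject₁ i)))))

-- Dimension, uniqueness of multiplicity lists, and similarity

module LinearAlgebra (ℝ : Reals) where
  open Reals ℝ hiding (zero)
  open OrderedField ℝ
  open IntegerCoefficients commutativeRing using (solve; con; _:=_; _:+_; _:*_; :-_; _:-_)
  open import Algebra.Properties.Semiring.Sum semiring
    using (sum-cong-≋; sum-replicate-zero; ∑-comm; ∑-distrib-+; *-distribˡ-sum; *-distribʳ-sum)
  open import Relation.Binary.Reasoning.Setoid setoid

  sum-0 : ∀ {n} {t : Vector Carrier n} → (∀ i → t i ≈ 0#) → sum t ≈ 0#
  sum-0 {n} t≈0 = trans (sum-cong-≋ t≈0) (sum-replicate-zero n)

  sum-*-assoc : ∀ {m n} (c : Vector Carrier m) (M : Fin m → Fin n → Carrier) (b : Vector Carrier n) →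
    sum (λ k → c k * sum (λ j → M k j * b j)) ≈ sum (λ j → sum (λ k → c k * M k j) * b j)
  sum-*-assoc {m} {n} c M b = begin
    sum (λ k → c k * sum (λ j → M k j * b j))     ≈⟨ sum-cong-≋ (λ k → *-distribˡ-sum (c k) (λ j → M k j * b j)) ⟩
    sum (λ k → sum (λ j → c k * (M k j * b j)))   ≈⟨ ∑-comm {m} {n} (λ k j → c k * (M k j * b j)) ⟩
    sum (λ j → sum (λ k → c k * (M k j * b j)))   ≈⟨ sum-cong-≋ (λ j → sum-cong-≋ (λ k → *-assoc (c k) (M k j) (b j))) ⟨
    sum (λ j → sum (λ k → c k * M k j * b j))     ≈⟨ sum-cong-≋ (λ j → *-distribʳ-sum (b j) (λ k → c k * M k j)) ⟨
    sum (λ j → sum (λ k → c k * M k j) * b j)     ∎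

  -- Gaussian elimination on the rows of `M`, by induction on the number of columns. A zero first
  -- row is a relation by itself; otherwise a nonzero entry of it clears its column, and the
  -- remaining rows with that column deleted are dependent by induction.
  dependent : ∀ {d n} (M : Fin n → Fin d → Carrier) → d ℕ.< n →
    ∃ λ (c : Vector Carrier n) → (∃[ k ] ¬ c k ≈ 0#) × (∀ j → sum (λ k → c k * M k j) ≈ 0#)
  dependent {zero}  {suc n} M _ = (λ _ → 1#) , (zero , λ 1≈0 → 0≉1 (sym 1≈0)) , λ ()
  dependent {suc d} {suc n} M (s≤s d<n) with Fin.any? (λ j → ¬? (M zero j ≟ 0#))
  ... | no ¬pivot = δ , (zero , λ 1≈0 → 0≉1 (sym 1≈0)) , λ j → begin
      1# * M zero j + sum (λ k → 0# * M (suc k) j)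
        ≈⟨ +-cong (trans (*-identityˡ _) (decidable-stable (M zero j ≟ 0#) (λ M0j≉0 → ¬pivot (j , M0j≉0))))
             (sum-0 {n} (λ k → zeroˡ (M (suc k) j))) ⟩
      0# + 0#  ≈⟨ +-identityˡ 0# ⟩
      0#       ∎
    where
    δ : Vector Carrier (suc n)
    δ zero    = 1#
    δ (suc _) = 0#
  ... | yes (j₀ , p≉0) = c , (suc k₀ , *-≉0 c′k₀≉0 p≉0) , λ j → trans (c-sum j) (vanish j)
    where
    p = M zero j₀
    -- Scaling the row by the pivot clears column `j₀` without a division.
    N : Fin n → Fin (suc d) → Carrier
    N k j = p * M (suc k) j - M (suc k) j₀ * M zero j

    rec = dependent (λ k j → N k (punchIn j₀ j)) d<n
    c′ = proj₁ rec
    k₀ = proj₁ (proj₁ (proj₂ rec))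
    c′k₀≉0 = proj₂ (proj₁ (proj₂ rec))
    s = sum (λ k → c′ k * M (suc k) j₀)

    c : Vector Carrier (suc n)
    -- This coefficient absorbs all multiples of the first row that the elimination subtracted.
    c zero    = - s
    c (suc k) = c′ k * p

    c-sum : ∀ j → sum (λ k → c k * M k j) ≈ sum (λ k → c′ k * N k j)
    c-sum j = begin
      - s * m + sum (λ k → c′ k * p * M (suc k) j)
        ≈⟨ +-congˡ (sum-cong-≋ (λ k → solve 5
             (λ c p x y m → c :* p :* x := c :* (p :* x :- y :* m) :+ c :* y :* m)
             refl (c′ k) p (M (suc k) j) (M (suc k) j₀) m)) ⟩
      - s * m + sum (λ k → c′ k * N k j + c′ k * M (suc k) j₀ * m)
        ≈⟨ +-congˡ (∑-distrib-+ (λ k → c′ k * N k j) (λ k → c′ k * M (suc k) j₀ * m)) ⟩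
      - s * m + (sum (λ k → c′ k * N k j) + sum (λ k → c′ k * M (suc k) j₀ * m))
        ≈⟨ +-congˡ (+-congˡ (*-distribʳ-sum m (λ k → c′ k * M (suc k) j₀))) ⟨
      - s * m + (sum (λ k → c′ k * N k j) + s * m)
        ≈⟨ solve 3 (λ s m x → :- s :* m :+ (x :+ s :* m) := x) refl s m (sum (λ k → c′ k * N k j)) ⟩
      sum (λ k → c′ k * N k j)  ∎
      where m = M zero j

    vanish : ∀ j → sum (λ k → c′ k * N k j) ≈ 0#
    vanish j with j₀ Fin.≟ j
    -- The cleared column vanishes identically; every other column is one of those in the recursive
    -- call.
    ... | yes ≡.refl = sum-0 (λ k → solve 3 (λ c p x → c :* (p :* x :- x :* p) := con (+ 0))
                         refl (c′ k) p (M (suc k) j₀))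
    ... | no j₀≢j = ≡.subst (λ j → sum (λ k → c′ k * N k j) ≈ 0#) (Fin.punchIn-punchOut j₀≢j)
                      (proj₂ (proj₂ rec) (punchOut j₀≢j))

  -- With `d` < `e`, the coordinate rows of `b′` with respect to `b` outnumber their columns. A
  -- relation among these rows is, by associativity, a relation among the vectors of `b′`.
  independent⇒≤dim : ∀ {n d e} {V : Pred (Vector Carrier n) 0ℓ}
    {b : Vector (Vector Carrier n) d} {b′ : Vector (Vector Carrier n) e} →
    IsBasis ℝ V b → IsBasis ℝ V b′ → e ℕ.≤ d
  independent⇒≤dim {b = b} {b′} B B′ = ℕ.≮⇒≥ λ d<e →
    let c , (k , ck≉0) , cM≈0 = dependent M d<e in
    ck≉0 (IsBasis.independent B′ c (λ i → begin
      sum (λ k → c k * b′ k i)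
        ≈⟨ sum-cong-≋ (λ k → *-congˡ (proj₂ (IsBasis.spanning B (b′ k) (IsBasis.members B′ k)) i)) ⟩
      sum (λ k → c k * sum (λ j → M k j * b j i))
        ≈⟨ sum-*-assoc c M (λ j → b j i) ⟩
      sum (λ j → sum (λ k → c k * M k j) * b j i)
        ≈⟨ sum-0 (λ j → trans (*-congʳ (cM≈0 j)) (zeroˡ _)) ⟩
      0# ∎) k)
    where
    M = λ k → proj₁ (IsBasis.spanning B (b′ k) (IsBasis.members B′ k))

  -- Two predicates with mutual inclusions are allowed because eigenspaces of ≈-equal eigenvalues
  -- are not the same predicate.
  dimension-unique : ∀ {n d e} {V W : Pred (Vector Carrier n) 0ℓ} →
    (∀ v → v ∈ V → v ∈ W) → (∀ v → v ∈ W → v ∈ V) →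
    HasDimension ℝ V d → HasDimension ℝ W e → d ≡ e
  dimension-unique V⊆W W⊆V (b , B) (b′ , B′) = ℕ.≤-antisym (independent⇒≤dim B″ B) (independent⇒≤dim B B″)
    where
    open IsBasis B′
    B″ = record { members = λ k → W⊆V _ (members k) ; independent = independent
                ; spanning = λ v v∈V → spanning v (V⊆W v v∈V) }

  Eigenspace-resp : ∀ {n} {A : Matrix ℝ n} {μ ν} → μ ≈ ν →
    ∀ v → v ∈ Eigenspace ℝ A μ → v ∈ Eigenspace ℝ A ν
  Eigenspace-resp μ≈ν v Av≈μv i = trans (Av≈μv i) (*-congʳ μ≈ν)

  module _ {n : ℕ} {A : Matrix ℝ n} {ms ms′ : List ℕ}
    (O : IsOrderedMultiplicityList ℝ A ms) (O′ : IsOrderedMultiplicityList ℝ A ms′) where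
    private
      module O = IsOrderedMultiplicityList O
      module O′ = IsOrderedMultiplicityList O′

    position : Fin (length ms) → Fin (length ms′)
    position i = proj₁ (O′.exhaustive (O.eigenvalue i) (O.isEigenvalue i))

    position-≈ : ∀ i → O.eigenvalue i ≈ O′.eigenvalue (position i)
    position-≈ i = proj₂ (O′.exhaustive (O.eigenvalue i) (O.isEigenvalue i))

    position-mono : ∀ {i j} → i Fin.< j → position i Fin.< position j
    position-mono {i} {j} i<j with Fin.<-cmp (position i) (position j)
    ... | tri< pi<pj _ _ = pi<pj
    ... | tri≈ _ pi≡pj _ = contradiction (trans (position-≈ i) (trans
            (reflexive (≡.cong O′.eigenvalue pi≡pj)) (sym (position-≈ j))))
            (<⇒≉ (O.increasing i j i<j))
    ... | tri> _ _ pj<pi = contradiction (O.increasing i j i<j) (<⇒≤ (≤-<-trans (≈⇒≤ (position-≈ j))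
            (<-≤-trans (O′.increasing _ _ pj<pi) (≈⇒≤ (sym (position-≈ i))))))

  module _ {n : ℕ} {A : Matrix ℝ n} {ms ms′ : List ℕ}
    (O : IsOrderedMultiplicityList ℝ A ms) (O′ : IsOrderedMultiplicityList ℝ A ms′) where
    private
      module O = IsOrderedMultiplicityList O
      module O′ = IsOrderedMultiplicityList O′

    -- The round trip preserves the eigenvalue up to ≈, and in a strictly increasing family the
    -- eigenvalue determines the index.
    position-involutive : ∀ i → position O′ O (position O O′ i) ≡ i
    position-involutive i with Fin.<-cmp (position O′ O (position O O′ i)) i
    ... | tri< k<i _ _ = contradiction (sym e≈) (<⇒≉ (O.increasing _ _ k<i))
      where e≈ = trans (position-≈ O O′ i) (position-≈ O′ O (position O O′ i))
    ... | tri≈ _ k≡i _ = k≡i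
    ... | tri> _ _ i<k = contradiction e≈ (<⇒≉ (O.increasing _ _ i<k))
      where e≈ = trans (position-≈ O O′ i) (position-≈ O′ O (position O O′ i))

    -- Both maps are strictly increasing, so an index is at most its image, which is at most the
    -- image of that under the way back, and this is the original index.
    position-toℕ : ∀ i → toℕ i ≡ toℕ (position O O′ i)
    position-toℕ i = ℕ.≤-antisym
      (mono-<⇒i≤f[i] (position O O′) (position-mono O O′) i)
      (ℕ.≤-trans (mono-<⇒i≤f[i] (position O′ O) (position-mono O′ O) (position O O′ i))
        (ℕ.≤-reflexive (≡.cong toℕ (position-involutive i))))

  orderedMultiplicityList-unique : ∀ {n} {A : Matrix ℝ n} {ms ms′} →
    IsOrderedMultiplicityList ℝ A ms → IsOrderedMultiplicityList ℝ A ms′ → ms ≡ ms′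
  orderedMultiplicityList-unique O O′ = lookup-ext _ _
    (λ i → position O O′ i , position-toℕ O O′ i ,
      dimension-unique (Eigenspace-resp (position-≈ O O′ i)) (Eigenspace-resp (sym (position-≈ O O′ i)))
        (IsOrderedMultiplicityList.multiplicities O i)
        (IsOrderedMultiplicityList.multiplicities O′ (position O O′ i)))
    (λ j → position O′ O j , position-toℕ O′ O j)

  infixr 8 _·_

  _·_ : ∀ {n} → Matrix ℝ n → Vector Carrier n → Vector Carrier n
  (A · v) i = sum (λ j → A i j * v j)

  ·-cong : ∀ {n} (A : Matrix ℝ n) {v w} → (∀ i → v i ≈ w i) → ∀ i → (A · v) i ≈ (A · w) i
  ·-cong A v≈w i = sum-cong-≋ (λ j → *-congˡ (v≈w j))

  ·-scale : ∀ {n} (A : Matrix ℝ n) μ v i → (A · (λ j → μ * v j)) i ≈ μ * (A · v) i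
  ·-scale A μ v i = trans
    (sum-cong-≋ (λ j → solve 3 (λ a μ v → a :* (μ :* v) := μ :* (a :* v)) refl (A i j) μ (v j)))
    (sym (*-distribˡ-sum μ (λ j → A i j * v j)))

  ·-linComb : ∀ {n d} (A : Matrix ℝ n) (c : Vector Carrier d) b i →
    (A · linComb ℝ c b) i ≈ linComb ℝ c (λ k → A · b k) i
  ·-linComb A c b i = begin
    sum (λ j → A i j * sum (λ k → c k * b k j))
      ≈⟨ sum-cong-≋ (λ j → *-congˡ (sum-cong-≋ (λ k → *-comm (c k) (b k j)))) ⟩
    sum (λ j → A i j * sum (λ k → b k j * c k))
      ≈⟨ sum-*-assoc (A i) (λ j k → b k j) c ⟩
    sum (λ k → sum (λ j → A i j * b k j) * c k)
      ≈⟨ sum-cong-≋ (λ k → *-comm _ (c k)) ⟩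
    sum (λ k → c k * sum (λ j → A i j * b k j))  ∎

  -- A matrix whose square is a nonzero scalar is its own inverse up to that scalar. This covers
  -- both changes of basis below, with κ = 4 and κ = 1, and one matrix `S` carries eigenvectors in
  -- both directions.
  module _ {n : ℕ} {A M S : Matrix ℝ n} {κ : Carrier} (κ≉0 : ¬ κ ≈ 0#)
    (S² : ∀ v i → (S · S · v) i ≈ κ * v i)
    (AS≈SM : ∀ v i → (A · S · v) i ≈ (S · M · v) i) where
    private
      κ⁻¹ = proj₁ (inverse κ κ≉0)

      κ⁻¹κ : ∀ x → κ⁻¹ * (κ * x) ≈ x
      κ⁻¹κ x = trans (solve 3 (λ k κ x → k :* (κ :* x) := (κ :* k) :* x) refl κ⁻¹ κ x)
        (trans (*-congʳ (proj₂ (inverse κ κ≉0))) (*-identityˡ x))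

      to : ∀ {μ v} → v ∈ Eigenspace ℝ M μ → S · v ∈ Eigenspace ℝ A μ
      to {μ} {v} Mv≈μv i = begin
        (A · S · v) i               ≈⟨ AS≈SM v i ⟩
        (S · M · v) i               ≈⟨ ·-cong S Mv≈μv i ⟩
        (S · (λ j → μ * v j)) i     ≈⟨ ·-scale S μ v i ⟩
        μ * (S · v) i               ∎

      from : ∀ {μ v} → v ∈ Eigenspace ℝ A μ → S · v ∈ Eigenspace ℝ M μ
      from {μ} {v} Av≈μv i = begin
        -- The relation MS = SA follows from AS = SM, since κMS = SSMS = SASS = κSA.
        (M · S · v) i                       ≈⟨ κ⁻¹κ _ ⟨
        κ⁻¹ * (κ * (M · S · v) i)           ≈⟨ *-congˡ (S² (M · S · v) i) ⟨
        κ⁻¹ * (S · S · M · S · v) i         ≈⟨ *-congˡ (·-cong S (AS≈SM (S · v)) i) ⟨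
        κ⁻¹ * (S · A · S · S · v) i         ≈⟨ *-congˡ (·-cong S (·-cong A (S² v)) i) ⟩
        κ⁻¹ * (S · A · (λ j → κ * v j)) i   ≈⟨ *-congˡ (·-cong S (·-scale A κ v) i) ⟩
        κ⁻¹ * (S · (λ j → κ * (A · v) j)) i ≈⟨ *-congˡ (·-scale S κ (A · v) i) ⟩
        κ⁻¹ * (κ * (S · A · v) i)           ≈⟨ κ⁻¹κ _ ⟩
        (S · A · v) i                       ≈⟨ ·-cong S Av≈μv i ⟩
        (S · (λ j → μ * v j)) i             ≈⟨ ·-scale S μ v i ⟩
        μ * (S · v) i                       ∎

      S-injective : ∀ {v} → (∀ i → (S · v) i ≈ 0#) → ∀ i → v i ≈ 0#
      S-injective {v} Sv≈0 i = *-cancel-0 κ≉0 (trans (sym (S² v i))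
        (sum-0 (λ j → trans (*-congˡ (Sv≈0 j)) (zeroʳ (S i j)))))

      basis : ∀ {μ d} {b : Vector (Vector Carrier n) d} → IsBasis ℝ (Eigenspace ℝ M μ) b →
        IsBasis ℝ (Eigenspace ℝ A μ) (λ k → S · b k)
      basis {b = b} B = record
        { members     = λ k → to (members k)
        ; independent = λ c cSb≈0 → independent c (S-injective
            (λ i → trans (·-linComb S c b i) (cSb≈0 i)))
        -- Because v = κ⁻¹ S (S v), the coordinates of S v in the old basis, divided by κ, are those
        -- of v in the new one.
        ; spanning    = λ v v∈E → let c , Sv≈cb = spanning (S · v) (from v∈E) in
            (λ k → κ⁻¹ * c k) , λ i → begin
              v i                                     ≈⟨ κ⁻¹κ (v i) ⟨
              κ⁻¹ * (κ * v i)                         ≈⟨ *-congˡ (S² v i) ⟨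
              κ⁻¹ * (S · S · v) i                     ≈⟨ *-congˡ (·-cong S Sv≈cb i) ⟩
              κ⁻¹ * (S · linComb ℝ c b) i             ≈⟨ *-congˡ (·-linComb S c b i) ⟩
              κ⁻¹ * sum (λ k → c k * (S · b k) i)     ≈⟨ *-distribˡ-sum κ⁻¹ (λ k → c k * (S · b k) i) ⟩
              sum (λ k → κ⁻¹ * (c k * (S · b k) i))   ≈⟨ sum-cong-≋ (λ k → *-assoc κ⁻¹ (c k) _) ⟨
              sum (λ k → κ⁻¹ * c k * (S · b k) i)     ∎
        }
        where open IsBasis B

    similar : ∀ {ms} → IsOrderedMultiplicityList ℝ M ms → IsOrderedMultiplicityList ℝ A ms
    similar O = record
      { eigenvalue     = eigenvalue
      ; increasing     = increasing
      ; isEigenvalue   = λ i → let v , v∈E , v≉0 = isEigenvalue i in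
          S · v , to v∈E , λ Sv≈0 → v≉0 (S-injective Sv≈0)
      ; exhaustive     = λ μ (v , v∈E , v≉0) →
          exhaustive μ (S · v , from v∈E , λ Sv≈0 → v≉0 (S-injective Sv≈0))
      ; multiplicities = λ i → let b , B = multiplicities i in (λ k → S · b k) , basis B
      }
      where open IsOrderedMultiplicityList O

-- Location of the roots of the characteristic cubic

module Cubics (ℝ : Reals) where
  open Reals ℝ hiding (zero)
  open OrderedField ℝ
  open IntegerCoefficients commutativeRing using (solve; con; _:=_; _:+_; _:*_; :-_; _:-_)

  infixl 6 _⊞_

  _⊞_ : ∀ {x y} → x ≈ 0# → y ≈ 0# → x + y ≈ 0#
  x≈0 ⊞ y≈0 = trans (+-cong x≈0 y≈0) (+-identityˡ 0#)

  *-zeroʳ : ∀ x {y} → y ≈ 0# → x * y ≈ 0#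
  *-zeroʳ x y≈0 = trans (*-congˡ y≈0) (zeroʳ x)

  *-zeroˡ : ∀ {x} y → x ≈ 0# → x * y ≈ 0#
  *-zeroˡ y x≈0 = trans (*-congʳ x≈0) (zeroˡ y)

  neg-≈0 : ∀ {x} → x ≈ 0# → - x ≈ 0#
  neg-≈0 {x} x≈0 = trans (-‿cong x≈0) (solve 0 (:- con (+ 0) := con (+ 0)) refl)

  cubic : (e₁ e₂ e₃ x : Carrier) → Carrier
  cubic e₁ e₂ e₃ x = x * x * x - e₁ * (x * x) + e₂ * x - e₃

  cubic-cong : ∀ e₁ e₂ e₃ {x y} → x ≈ y → cubic e₁ e₂ e₃ x ≈ cubic e₁ e₂ e₃ y
  cubic-cong e₁ e₂ e₃ x≈y = +-congʳ (+-cong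
    (+-cong (*-cong (*-cong x≈y x≈y) x≈y) (-‿cong (*-congˡ (*-cong x≈y x≈y)))) (*-congˡ x≈y))

  -- For 0 ≤ x ≤ y ≤ h the difference quotient y² + xy + x² - e₁ (x + y) + e₂ is at most e₂ + 3h²,
  -- which serves as the one-sided Lipschitz constant.
  cubic-ivt : ∀ {e₁ e₂ e₃ l h} → 0# ≤ e₁ → 0# < e₂ → 0# ≤ l → l ≤ h →
    cubic e₁ e₂ e₃ l ≤ 0# → 0# ≤ cubic e₁ e₂ e₃ h →
    ∃[ r ] l ≤ r × r ≤ h × cubic e₁ e₂ e₃ r ≈ 0#
  cubic-ivt {e₁} {e₂} {e₃} {l} {h} 0≤e₁ 0<e₂ 0≤l l≤h =
    ivt (cubic e₁ e₂ e₃) (cubic-cong e₁ e₂ e₃) l≤h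
      (+-pos-nonNeg 0<e₂ (+-nonNeg (+-nonNeg 0≤h² 0≤h²) 0≤h²)) lipschitz
    where
    0≤h² = sq-nonNeg h
    lipschitz : ∀ {x y} → l ≤ x → x ≤ y → y ≤ h →
      0# ≤ (e₂ + (h * h + h * h + h * h)) * (y - x) - (cubic e₁ e₂ e₃ y - cubic e₁ e₂ e₃ x)
    lipschitz {x} {y} l≤x x≤y y≤h = 0≤-resp
      (solve 6 (λ e₁ e₂ e₃ h x y →
          -- The first three brackets are h² - y², h² - xy and h² - x², each split into visibly
          -- nonnegative products.
          (y :- x) :* ((h :* (h :- y) :+ y :* (h :- y)) :+ (h :* (h :- x) :+ x :* (h :- y))
                       :+ (h :* (h :- x) :+ x :* (h :- x)) :+ e₁ :* (x :+ y))
            := (e₂ :+ (h :* h :+ h :* h :+ h :* h)) :* (y :- x)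
               :- ((y :* y :* y :- e₁ :* (y :* y) :+ e₂ :* y :- e₃)
                   :- (x :* x :* x :- e₁ :* (x :* x) :+ e₂ :* x :- e₃)))
        refl e₁ e₂ e₃ h x y)
      (*-nonNeg (≤⇒0≤- x≤y) (+-nonNeg (+-nonNeg (+-nonNeg
        (+-nonNeg (*-nonNeg 0≤h h-y) (*-nonNeg 0≤y h-y))
        (+-nonNeg (*-nonNeg 0≤h h-x) (*-nonNeg 0≤x h-y)))
        (+-nonNeg (*-nonNeg 0≤h h-x) (*-nonNeg 0≤x h-x)))
        (*-nonNeg 0≤e₁ (+-nonNeg 0≤x 0≤y))))
      where
      0≤x = ≤-trans 0≤l l≤x
      0≤y = ≤-trans 0≤x x≤y
      0≤h = ≤-trans 0≤y y≤h
      h-y = ≤⇒0≤- y≤h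
      h-x = ≤⇒0≤- (≤-trans x≤y y≤h)

  -- Vieta's formulas, rather than the vanishing of the cubic at three points, so that a repeated
  -- root is counted with its multiplicity.
  record IsRoots (e₁ e₂ e₃ r₁ r₂ r₃ : Carrier) : Set where
    constructor roots
    field
      e₁≈ : e₁ ≈ r₁ + r₂ + r₃
      e₂≈ : e₂ ≈ r₁ * r₂ + r₁ * r₃ + r₂ * r₃
      e₃≈ : e₃ ≈ r₁ * r₂ * r₃

    cubic-factors : ∀ x → cubic e₁ e₂ e₃ x ≈ (x - r₁) * ((x - r₂) * (x - r₃))
    cubic-factors x = trans
      (+-cong (+-cong (+-congˡ (-‿cong (*-congʳ e₁≈))) (*-congʳ e₂≈)) (-‿cong e₃≈))
      (solve 4 (λ x a b c → x :* x :* x :- (a :+ b :+ c) :* (x :* x)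
                              :+ (a :* b :+ a :* c :+ b :* c) :* x :- a :* b :* c
                            := (x :- a) :* ((x :- b) :* (x :- c))) refl x r₁ r₂ r₃)

    root₁ : cubic e₁ e₂ e₃ r₁ ≈ 0#
    root₁ = trans (cubic-factors r₁) (*-zeroˡ ((r₁ - r₂) * (r₁ - r₃)) (-‿inverseʳ r₁))

  IsRoots-swap₁₂ : ∀ {e₁ e₂ e₃ r₁ r₂ r₃} → IsRoots e₁ e₂ e₃ r₁ r₂ r₃ → IsRoots e₁ e₂ e₃ r₂ r₁ r₃
  IsRoots-swap₁₂ {r₁ = r₁} {r₂} {r₃} (roots e₁≈ e₂≈ e₃≈) = roots
    (trans e₁≈ (solve 3 (λ a b c → a :+ b :+ c := b :+ a :+ c) refl r₁ r₂ r₃))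
    (trans e₂≈ (solve 3 (λ a b c → a :* b :+ a :* c :+ b :* c := b :* a :+ b :* c :+ a :* c) refl r₁ r₂ r₃))
    (trans e₃≈ (solve 3 (λ a b c → a :* b :* c := b :* a :* c) refl r₁ r₂ r₃))

  IsRoots-swap₁₃ : ∀ {e₁ e₂ e₃ r₁ r₂ r₃} → IsRoots e₁ e₂ e₃ r₁ r₂ r₃ → IsRoots e₁ e₂ e₃ r₃ r₂ r₁
  IsRoots-swap₁₃ {r₁ = r₁} {r₂} {r₃} (roots e₁≈ e₂≈ e₃≈) = roots
    (trans e₁≈ (solve 3 (λ a b c → a :+ b :+ c := c :+ b :+ a) refl r₁ r₂ r₃))
    (trans e₂≈ (solve 3 (λ a b c → a :* b :+ a :* c :+ b :* c := c :* b :+ c :* a :+ b :* a) refl r₁ r₂ r₃))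
    (trans e₃≈ (solve 3 (λ a b c → a :* b :* c := c :* b :* a) refl r₁ r₂ r₃))

  -- The third root is forced by the sum `e₁`. The difference of the cubic at `r₁` and `r₃` is r₁ -
  -- r₃ times the error in Vieta's second formula, so that error is zero; the value at `r₁` then
  -- yields the third formula.
  two-roots⇒IsRoots : ∀ {e₁ e₂ e₃ r₁ r₃} → ¬ r₁ ≈ r₃ →
    cubic e₁ e₂ e₃ r₁ ≈ 0# → cubic e₁ e₂ e₃ r₃ ≈ 0# →
    IsRoots e₁ e₂ e₃ r₁ (e₁ - r₁ - r₃) r₃
  two-roots⇒IsRoots {e₁} {e₂} {e₃} {r₁} {r₃} r₁≉r₃ root₁ root₃ = roots
    (solve 3 (λ e a c → e := a :+ (e :- a :- c) :+ c) refl e₁ r₁ r₃)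
    (-≈0⇒≈ e₂-≈0)
    (-≈0⇒≈ (trans
      (solve 5 (λ e₁ e₂ e₃ a c →
          e₃ :- a :* (e₁ :- a :- c) :* c
            := :- (a :* a :* a :- e₁ :* (a :* a) :+ e₂ :* a :- e₃)
               :+ a :* (e₂ :- (a :* (e₁ :- a :- c) :+ a :* c :+ (e₁ :- a :- c) :* c)))
        refl e₁ e₂ e₃ r₁ r₃)
      (neg-≈0 root₁ ⊞ *-zeroʳ r₁ e₂-≈0)))
    where
    r₂ = e₁ - r₁ - r₃
    e₂-≈0 : e₂ - (r₁ * r₂ + r₁ * r₃ + r₂ * r₃) ≈ 0#
    e₂-≈0 = *-cancel-0 (λ r₁-r₃≈0 → r₁≉r₃ (-≈0⇒≈ r₁-r₃≈0)) (trans
      (solve 5 (λ e₁ e₂ e₃ a c →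
          (a :- c) :* (e₂ :- (a :* (e₁ :- a :- c) :+ a :* c :+ (e₁ :- a :- c) :* c))
            := (a :* a :* a :- e₁ :* (a :* a) :+ e₂ :* a :- e₃)
               :+ :- (c :* c :* c :- e₁ :* (c :* c) :+ e₂ :* c :- e₃))
        refl e₁ e₂ e₃ r₁ r₃)
      (root₁ ⊞ neg-≈0 root₃))

  -- The quadratic (x - m) (x - s) - w takes the value - w ≤ 0 at s and ms - w > 0 at s + m, so a
  -- root lies between. The other root is read off from the sum m + s, and its sign from the
  -- product.
  quadratic-roots : ∀ {m s w} → 0# < m → m < s → 0# ≤ w → 0# < m * s - w →
    ∃[ r ] ∃[ r′ ] 0# < r × r < r′ × s ≤ r′ × r + r′ ≈ m + s × r * r′ ≈ m * s - w
  quadratic-roots {m} {s} {w} 0<m m<s 0≤w 0<ms-w = r , r′ , 0<r , r<r′ , s≤r′ , r+r′ , rr′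
    where
    g : Carrier → Carrier
    g x = (x - m) * (x - s) - w

    0<s = <-trans 0<m m<s

    lipschitz : ∀ {x y} → s ≤ x → x ≤ y → y ≤ s + m →
      0# ≤ (s + m + (s + m)) * (y - x) - (g y - g x)
    lipschitz {x} {y} _ x≤y y≤h = 0≤-resp
      (solve 5 (λ m s w x y →
          (y :- x) :* ((s :+ m :- y) :+ (s :+ m :- x) :+ (s :+ m))
            := (s :+ m :+ (s :+ m)) :* (y :- x)
               :- (((y :- m) :* (y :- s) :- w) :- ((x :- m) :* (x :- s) :- w)))
        refl m s w x y)
      (*-nonNeg (≤⇒0≤- x≤y) (+-nonNeg (+-nonNeg (≤⇒0≤- y≤h) (≤⇒0≤- (≤-trans x≤y y≤h)))
        (<⇒≤ (+-pos 0<s 0<m))))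

    root = ivt g
      (λ x≈y → +-congʳ (*-cong (+-congʳ x≈y) (+-congʳ x≈y)))
      (0≤-⇒≤ (0≤-resp (solve 2 (λ s m → m := s :+ m :- s) refl s m) (<⇒≤ 0<m)))
      (+-pos (+-pos 0<s 0<m) (+-pos 0<s 0<m))
      lipschitz
      (0≤-⇒≤ (0≤-resp (solve 3 (λ m s w → w := con (+ 0) :- ((s :- m) :* (s :- s) :- w)) refl m s w) 0≤w))
      (0≤-resp (solve 3 (λ m s w → m :* s :- w := (s :+ m :- m) :* (s :+ m :- s) :- w) refl m s w) (<⇒≤ 0<ms-w))

    r′ = proj₁ root
    s≤r′ = proj₁ (proj₂ root)
    r = m + s - r′
    r+r′ = solve 3 (λ m s r → m :+ s :- r :+ r := m :+ s) refl m s r′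
    rr′ : r * r′ ≈ m * s - w
    rr′ = -≈0⇒≈ (trans
      (solve 4 (λ m s w r → (m :+ s :- r) :* r :- (m :* s :- w) := :- ((r :- m) :* (r :- s) :- w))
        refl m s w r′)
      (neg-≈0 (proj₂ (proj₂ (proj₂ root)))))
    0<r′ = <-≤-trans 0<s s≤r′
    0<r = *-pos-cancelˡ (<⇒≤ 0<r′) (0<-resp (trans (sym rr′) (*-comm r r′)) 0<ms-w)
    r<r′ : r < r′
    -- The gap between the roots is (s - m) + 2 (r′ - s).
    r<r′ = 0<-⇒< (0<-resp
      (solve 3 (λ m s r → (s :- m) :+ (r :- s) :+ (r :- s) := r :- (m :+ s :- r)) refl m s r′)
      (+-pos-nonNeg (+-pos-nonNeg (<⇒0<- m<s) (≤⇒0≤- s≤r′)) (≤⇒0≤- s≤r′)))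

  DistinctPositiveRoots : (e₁ e₂ e₃ : Carrier) → Set
  DistinctPositiveRoots e₁ e₂ e₃ =
    ∃[ r₁ ] ∃[ r₂ ] ∃[ r₃ ] 0# < r₁ × r₁ < r₂ × r₂ < r₃ × IsRoots e₁ e₂ e₃ r₁ r₂ r₃

  -- The first three hypotheses factor the cubic as (x - ρ) (x² - bx + c), and the last two make r
  -- and r′ the roots of the quadratic.
  factor⇒IsRoots : ∀ {e₁ e₂ e₃ ρ b c r r′} → e₁ ≈ ρ + b → e₂ ≈ ρ * b + c → e₃ ≈ ρ * c →
    r + r′ ≈ b → r * r′ ≈ c → IsRoots e₁ e₂ e₃ ρ r r′
  factor⇒IsRoots {ρ = ρ} {r = r} {r′} e₁≈ e₂≈ e₃≈ r+r′ rr′ = roots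
    (trans e₁≈ (trans (+-congˡ (sym r+r′)) (sym (+-assoc ρ r r′))))
    (trans e₂≈ (trans (+-cong (*-congˡ (sym r+r′)) (sym rr′)) (+-congʳ (distribˡ ρ r r′))))
    (trans e₃≈ (trans (*-congˡ (sym rr′)) (sym (*-assoc ρ r r′))))

  -- The quotient by x - ρ is (x - m) (x - s) - w. Its larger root is at least s > ρ, so only the
  -- smaller one can equal ρ, and then the quadratic vanishes at ρ.
  rational-root⇒distinct : ∀ {e₁ e₂ e₃ ρ m s w} → 0# < ρ → ρ < s →
    0# < m → m < s → 0# ≤ w → 0# < m * s - w →
    e₁ ≈ ρ + (m + s) → e₂ ≈ ρ * (m + s) + (m * s - w) → e₃ ≈ ρ * (m * s - w) →
    DistinctPositiveRoots e₁ e₂ e₃ ⊎ (ρ - m) * (ρ - s) ≈ w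
  rational-root⇒distinct {e₁} {e₂} {e₃} {ρ} {m} {s} {w} 0<ρ ρ<s 0<m m<s 0≤w 0<ms-w e₁≈ e₂≈ e₃≈ =
    let r , r′ , 0<r , r<r′ , s≤r′ , r+r′ , rr′ = quadratic-roots 0<m m<s 0≤w 0<ms-w
    in sort r r′ 0<r r<r′ (<-≤-trans ρ<s s≤r′) r+r′ rr′
    where
    sort : ∀ r r′ → 0# < r → r < r′ → ρ < r′ → r + r′ ≈ m + s → r * r′ ≈ m * s - w →
      DistinctPositiveRoots e₁ e₂ e₃ ⊎ (ρ - m) * (ρ - s) ≈ w
    sort r r′ 0<r r<r′ ρ<r′ r+r′ rr′ with compare ρ r
    ... | tri< ρ<r _ _ = inj₁ (ρ , r , r′ , 0<ρ , ρ<r , r<r′ , factor⇒IsRoots e₁≈ e₂≈ e₃≈ r+r′ rr′)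
    ... | tri> _ _ r<ρ = inj₁ (r , ρ , r′ , 0<r , r<ρ , ρ<r′ ,
            IsRoots-swap₁₂ (factor⇒IsRoots e₁≈ e₂≈ e₃≈ r+r′ rr′))
    ... | tri≈ _ ρ≈r _ = inj₂ (-≈0⇒≈ (trans
        (solve 6 (λ ρ m s w r r′ → (ρ :- m) :* (ρ :- s) :- w
             := (ρ :- r) :* (ρ :- r′) :+ ρ :* ((r :+ r′) :- (m :+ s)) :+ :- (r :* r′ :- (m :* s :- w)))
          refl ρ m s w r r′)
        (*-zeroˡ (ρ - r′) (≈⇒-≈0 ρ≈r) ⊞ *-zeroʳ ρ (≈⇒-≈0 r+r′) ⊞ neg-≈0 (≈⇒-≈0 rr′))))

  -- σ₁, σ₂, σ₃ are the elementary symmetric functions of the eigenvalues of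
  -- the arrowhead matrix with rows (P, 0, y), (0, Q, z), (y, z, P + Q).
  σ₁ : (P Q : Carrier) → Carrier
  σ₁ P Q = P + Q + (P + Q)

  σ₂ : (P Q y z : Carrier) → Carrier
  σ₂ P Q y z = P * Q + (P + Q) * (P + Q) - y * y - z * z

  σ₃ : (P Q y z : Carrier) → Carrier
  σ₃ P Q y z = P * Q * (P + Q) - y * y * Q - z * z * P

  DistinctSpectrum : (P Q y z : Carrier) → Set
  DistinctSpectrum P Q y z = DistinctPositiveRoots (σ₁ P Q) (σ₂ P Q y z) (σ₃ P Q y z)

  -- In this case P is a double root and the third root is Q + Q.
  Degenerate : (P Q y z : Carrier) → Set
  Degenerate P Q y z = y ≈ 0# × z * z ≈ Q * (Q - P)

  DistinctSpectrum-swap : ∀ {P Q y z} → DistinctSpectrum Q P z y → DistinctSpectrum P Q y z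
  DistinctSpectrum-swap {P} {Q} {y} {z} (r₁ , r₂ , r₃ , 0<r₁ , r₁<r₂ , r₂<r₃ , roots e₁≈ e₂≈ e₃≈) =
    r₁ , r₂ , r₃ , 0<r₁ , r₁<r₂ , r₂<r₃ , roots
      (trans (solve 2 (λ P Q → P :+ Q :+ (P :+ Q) := Q :+ P :+ (Q :+ P)) refl P Q) e₁≈)
      (trans (solve 4 (λ P Q y z → P :* Q :+ (P :+ Q) :* (P :+ Q) :- y :* y :- z :* z
                        := Q :* P :+ (Q :+ P) :* (Q :+ P) :- z :* z :- y :* y) refl P Q y z) e₂≈)
      (trans (solve 4 (λ P Q y z → P :* Q :* (P :+ Q) :- y :* y :* Q :- z :* z :* P
                        := Q :* P :* (Q :+ P) :- z :* z :* P :- y :* y :* Q) refl P Q y z) e₃≈)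

  module _ {P Q y z : Carrier} (0<P : 0# < P) (0<Q : 0# < Q)
    (y²<P² : 0# < P * P - y * y) (z²<Q² : 0# < Q * Q - z * z) where
    private
      χ = cubic (σ₁ P Q) (σ₂ P Q y z) (σ₃ P Q y z)
      0<P+Q = +-pos 0<P 0<Q
      P<P+Q : P < P + Q
      P<P+Q = 0<-⇒< (0<-resp (solve 2 (λ P Q → Q := P :+ Q :- P) refl P Q) 0<Q)
      Q<P+Q : Q < P + Q
      Q<P+Q = 0<-⇒< (0<-resp (solve 2 (λ P Q → P := P :+ Q :- Q) refl P Q) 0<P)

    -- For y = 0 the arrowhead matrix splits into the entry P and the block with rows (Q, z), (z, P
    -- + Q), whose characteristic polynomial is the quadratic with m = Q, s = P + Q, w = z².
    degenerate⊎distinct : y ≈ 0# → Degenerate P Q y z ⊎ DistinctSpectrum P Q y z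
    degenerate⊎distinct y≈0 = Sum.[ inj₂ , (λ z²≈ → inj₁ (y≈0 , trans (sym z²≈)
        (solve 2 (λ P Q → (P :- Q) :* (P :- (P :+ Q)) := Q :* (Q :- P)) refl P Q))) ]′
      (rational-root⇒distinct {ρ = P} {Q} {P + Q} {z * z} 0<P P<P+Q 0<Q Q<P+Q (sq-nonNeg z) 0<ms-w e₁≈ e₂≈ e₃≈)
      where
      0<ms-w : 0# < Q * (P + Q) - z * z
      0<ms-w = 0<-resp
        (solve 3 (λ P Q z → Q :* Q :- z :* z :+ P :* Q := Q :* (P :+ Q) :- z :* z) refl P Q z)
        (+-pos z²<Q² (*-pos 0<P 0<Q))
      e₁≈ : σ₁ P Q ≈ P + (Q + (P + Q))
      e₁≈ = +-assoc P Q (P + Q)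
      e₂≈ : σ₂ P Q y z ≈ P * (Q + (P + Q)) + (Q * (P + Q) - z * z)
      e₂≈ = -≈0⇒≈ (trans
        (solve 4 (λ P Q y z → P :* Q :+ (P :+ Q) :* (P :+ Q) :- y :* y :- z :* z
            :- (P :* (Q :+ (P :+ Q)) :+ (Q :* (P :+ Q) :- z :* z)) := (:- y) :* y) refl P Q y z)
        (*-zeroʳ (- y) y≈0))
      e₃≈ : σ₃ P Q y z ≈ P * (Q * (P + Q) - z * z)
      e₃≈ = -≈0⇒≈ (trans
        (solve 4 (λ P Q y z → P :* Q :* (P :+ Q) :- y :* y :* Q :- z :* z :* P
            :- P :* (Q :* (P :+ Q) :- z :* z) := (:- (y :* Q)) :* y) refl P Q y z)
        (*-zeroʳ (- (y * Q)) y≈0))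

    -- Now (z, -y, 0) is an eigenvector for P, and the quotient quadratic has w = y² + z². A
    -- coincidence at P = m would make w zero, which y excludes.
    distinct-P≈Q : P ≈ Q → ¬ y ≈ 0# → DistinctSpectrum P Q y z
    distinct-P≈Q P≈Q y≉0 = Sum.[ (λ distinct → distinct) , (λ 0≈w → contradiction
        (trans (sym (*-zeroˡ (P - (P + Q)) (≈⇒-≈0 P≈Q))) 0≈w) (<⇒≉ 0<w)) ]′
      (rational-root⇒distinct {ρ = P} {Q} {P + Q} {y * y + z * z} 0<P P<P+Q 0<Q Q<P+Q (<⇒≤ 0<w) 0<ms-w e₁≈ e₂≈ e₃≈)
      where
      0<w : 0# < y * y + z * z
      0<w = +-pos-nonNeg (sq-pos y≉0) (sq-nonNeg z)
      0<ms-w : 0# < Q * (P + Q) - (y * y + z * z)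
      0<ms-w = 0<-resp (sym (-≈0⇒≈ (trans
          (solve 4 (λ P Q y z → Q :* (P :+ Q) :- (y :* y :+ z :* z)
                       :- ((P :* P :- y :* y) :+ (Q :* Q :- z :* z)) := (:- P) :* (P :- Q)) refl P Q y z)
          (*-zeroʳ (- P) (≈⇒-≈0 P≈Q)))))
        (+-pos y²<P² z²<Q²)
      e₁≈ : σ₁ P Q ≈ P + (Q + (P + Q))
      e₁≈ = +-assoc P Q (P + Q)
      e₂≈ : σ₂ P Q y z ≈ P * (Q + (P + Q)) + (Q * (P + Q) - (y * y + z * z))
      e₂≈ = solve 4 (λ P Q y z → P :* Q :+ (P :+ Q) :* (P :+ Q) :- y :* y :- z :* z
          := P :* (Q :+ (P :+ Q)) :+ (Q :* (P :+ Q) :- (y :* y :+ z :* z))) refl P Q y z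
      e₃≈ : σ₃ P Q y z ≈ P * (Q * (P + Q) - (y * y + z * z))
      e₃≈ = -≈0⇒≈ (trans
        (solve 4 (λ P Q y z → P :* Q :* (P :+ Q) :- y :* y :* Q :- z :* z :* P
            :- P :* (Q :* (P :+ Q) :- (y :* y :+ z :* z)) := y :* y :* (P :- Q)) refl P Q y z)
        (*-zeroʳ (y * y) (≈⇒-≈0 P≈Q)))

    -- The smallest root lies below P and the largest above Q; the remaining
    -- one lies strictly between since χ(P) > 0 > χ(Q).
    distinct-P<Q : P < Q → ¬ y ≈ 0# → ¬ z ≈ 0# → DistinctSpectrum P Q y z
    distinct-P<Q P<Q y≉0 z≉0 = r₁ , r₂ , r₃ , 0<r₁ , ≤-<-trans r₁≤P P<r₂ , <-≤-trans r₂<Q Q≤r₃ , isRoots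
      where
      h = P + Q + (P + Q)
      0≤σ₁ = <⇒≤ (+-pos 0<P+Q 0<P+Q)
      0<σ₂ : 0# < σ₂ P Q y z
      0<σ₂ = 0<-resp
        (solve 4 (λ P Q y z → (P :* P :- y :* y) :+ (Q :* Q :- z :* z) :+ (P :* Q :+ P :* Q :+ P :* Q)
            := P :* Q :+ (P :+ Q) :* (P :+ Q) :- y :* y :- z :* z) refl P Q y z)
        (+-pos (+-pos y²<P² z²<Q²) (+-pos (+-pos PQ PQ) PQ))
        where PQ = *-pos 0<P 0<Q

      χ0<0 : 0# < - χ 0#
      χ0<0 = 0<-resp
        (solve 6 (λ P Q y z e₁ e₂ → Q :* (P :* P :- y :* y) :+ P :* (Q :* Q :- z :* z)
            := :- (con (+ 0) :* con (+ 0) :* con (+ 0) :- e₁ :* (con (+ 0) :* con (+ 0)) :+ e₂ :* con (+ 0)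
                   :- (P :* Q :* (P :+ Q) :- y :* y :* Q :- z :* z :* P))) refl P Q y z (σ₁ P Q) (σ₂ P Q y z))
        (+-pos (*-pos 0<Q y²<P²) (*-pos 0<P z²<Q²))

      0<χP : 0# < χ P
      0<χP = 0<-resp
        (solve 4 (λ P Q y z → y :* y :* (Q :- P)
            := P :* P :* P :- (P :+ Q :+ (P :+ Q)) :* (P :* P)
               :+ (P :* Q :+ (P :+ Q) :* (P :+ Q) :- y :* y :- z :* z) :* P
               :- (P :* Q :* (P :+ Q) :- y :* y :* Q :- z :* z :* P)) refl P Q y z)
        (*-pos (sq-pos y≉0) (<⇒0<- P<Q))

      χQ<0 : 0# < - χ Q
      χQ<0 = 0<-resp
        (solve 4 (λ P Q y z → z :* z :* (Q :- P)
            := :- (Q :* Q :* Q :- (P :+ Q :+ (P :+ Q)) :* (Q :* Q)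
               :+ (P :* Q :+ (P :+ Q) :* (P :+ Q) :- y :* y :- z :* z) :* Q
               :- (P :* Q :* (P :+ Q) :- y :* y :* Q :- z :* z :* P))) refl P Q y z)
        (*-pos (sq-pos z≉0) (<⇒0<- P<Q))

      -- As h is σ₁, the two leading terms cancel and χ(h) = σ₁σ₂ - σ₃.
      0<χh : 0# < χ h
      0<χh = 0<-resp
        (solve 4 (λ P Q y z →
            (P :* P :- y :* y) :* (P :+ (P :+ Q)) :+ (Q :* Q :- z :* z) :* (Q :+ (P :+ Q))
            :+ (P :* Q :* (P :+ Q) :+ P :* Q :* (P :+ Q) :+ P :* Q :* (P :+ Q)
                :+ P :* Q :* (P :+ Q) :+ P :* Q :* (P :+ Q) :+ P :* Q :* (P :+ Q))
            := (P :+ Q :+ (P :+ Q)) :* (P :+ Q :+ (P :+ Q)) :* (P :+ Q :+ (P :+ Q))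
               :- (P :+ Q :+ (P :+ Q)) :* ((P :+ Q :+ (P :+ Q)) :* (P :+ Q :+ (P :+ Q)))
               :+ (P :* Q :+ (P :+ Q) :* (P :+ Q) :- y :* y :- z :* z) :* (P :+ Q :+ (P :+ Q))
               :- (P :* Q :* (P :+ Q) :- y :* y :* Q :- z :* z :* P)) refl P Q y z)
        (+-pos (+-pos (*-pos y²<P² (+-pos 0<P 0<P+Q)) (*-pos z²<Q² (+-pos 0<Q 0<P+Q)))
          (+-pos (+-pos (+-pos (+-pos (+-pos t t) t) t) t) t))
        where t = *-pos (*-pos 0<P 0<Q) 0<P+Q

      -neg : ∀ {x} → 0# < - x → x ≤ 0#
      -neg {x} 0<-x = 0≤-⇒≤ (<⇒≤ (0<-resp (sym (+-identityˡ (- x))) 0<-x))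

      Q≤h : Q ≤ h
      Q≤h = 0≤-⇒≤ (0≤-resp (solve 2 (λ P Q → P :+ (P :+ Q) := P :+ Q :+ (P :+ Q) :- Q) refl P Q)
        (<⇒≤ (+-pos 0<P 0<P+Q)))

      lowest = cubic-ivt {e₃ = σ₃ P Q y z} 0≤σ₁ 0<σ₂ (≈⇒≤ refl) (<⇒≤ 0<P) (-neg χ0<0) (<⇒≤ 0<χP)
      highest = cubic-ivt {e₃ = σ₃ P Q y z} 0≤σ₁ 0<σ₂ (<⇒≤ 0<Q) Q≤h (-neg χQ<0) (<⇒≤ 0<χh)

      r₁ = proj₁ lowest
      r₁≤P = proj₁ (proj₂ (proj₂ lowest))
      r₃ = proj₁ highest
      Q≤r₃ = proj₁ (proj₂ highest)
      -- The middle root comes from the sum of the roots, and the signs of χ(P) and χ(Q) then place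
      -- it strictly between P and Q.
      r₂ = σ₁ P Q - r₁ - r₃

      χr₁≈0 = proj₂ (proj₂ (proj₂ lowest))
      χr₃≈0 = proj₂ (proj₂ (proj₂ highest))

      0<r₁ : 0# < r₁
      0<r₁ = ≤∧≉⇒< (proj₁ (proj₂ lowest)) λ 0≈r₁ → <⇒≉ χ0<0 (sym (neg-≈0
        (trans (cubic-cong (σ₁ P Q) (σ₂ P Q y z) (σ₃ P Q y z) 0≈r₁) χr₁≈0)))

      P<r₃ = <-≤-trans P<Q Q≤r₃
      r₁<Q = ≤-<-trans r₁≤P P<Q

      isRoots = two-roots⇒IsRoots (<⇒≉ (<-≤-trans r₁<Q Q≤r₃)) χr₁≈0 χr₃≈0

      P<r₂ : P < r₂
      -- In χ(P) = (P - r₁) (r₃ - P) (r₂ - P) > 0 the first two factors are nonnegative, hence the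
      -- last is positive.
      P<r₂ = 0<-⇒< (*-pos-cancelˡ (<⇒≤ (<⇒0<- P<r₃)) (*-pos-cancelˡ (≤⇒0≤- r₁≤P)
        (0<-resp (trans (IsRoots.cubic-factors isRoots P)
            (solve 4 (λ P a b c → (P :- a) :* ((P :- b) :* (P :- c)) := (P :- a) :* ((c :- P) :* (b :- P)))
              refl P r₁ r₂ r₃))
          0<χP)))

      r₂<Q : r₂ < Q
      r₂<Q = 0<-⇒< (*-pos-cancelˡ (≤⇒0≤- Q≤r₃) (*-pos-cancelˡ (<⇒≤ (<⇒0<- r₁<Q))
        (0<-resp (trans (-‿cong (IsRoots.cubic-factors isRoots Q))
            (solve 4 (λ Q a b c → :- ((Q :- a) :* ((Q :- b) :* (Q :- c))) := (Q :- a) :* ((c :- Q) :* (Q :- b)))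
              refl Q r₁ r₂ r₃))
          χQ<0)))

  spectrum : ∀ {P Q y z} → 0# < P → 0# < Q → 0# < P * P - y * y → 0# < Q * Q - z * z →
    DistinctSpectrum P Q y z ⊎ Degenerate P Q y z ⊎ Degenerate Q P z y
  spectrum {P} {Q} {y} {z} 0<P 0<Q y²<P² z²<Q² with y ≟ 0# | z ≟ 0# | compare P Q
  ... | yes y≈0 | _ | _ =
    Sum.[ (λ degenerate → inj₂ (inj₁ degenerate)) , inj₁ ]′ (degenerate⊎distinct 0<P 0<Q y²<P² z²<Q² y≈0)
  ... | no _ | yes z≈0 | _ =
    Sum.[ (λ degenerate → inj₂ (inj₂ degenerate)) , (λ distinct → inj₁ (DistinctSpectrum-swap distinct)) ]′
      (degenerate⊎distinct 0<Q 0<P z²<Q² y²<P² z≈0)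
  ... | no y≉0 | no z≉0 | tri< P<Q _ _ = inj₁ (distinct-P<Q 0<P 0<Q y²<P² z²<Q² P<Q y≉0 z≉0)
  ... | no y≉0 | no z≉0 | tri≈ _ P≈Q _ = inj₁ (distinct-P≈Q 0<P 0<Q y²<P² z²<Q² P≈Q y≉0)
  ... | no y≉0 | no z≉0 | tri> _ _ Q<P =
    inj₁ (DistinctSpectrum-swap (distinct-P<Q 0<Q 0<P z²<Q² y²<P² Q<P z≉0 y≉0))

-- One-dimensional eigenspaces

module Eigenlines (ℝ : Reals) where
  open Reals ℝ hiding (zero)
  open OrderedField ℝ
  open LinearAlgebra ℝ
  open Cubics ℝ
  open IntegerCoefficients commutativeRing using (solve; con; _:=_; _:+_; _:*_; :-_; _:-_)
  open import Algebra.Properties.Semiring.Sum semiring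
    using (sum-cong-≋; ∑-distrib-+; *-distribˡ-sum)
  open import Relation.Binary.Reasoning.Setoid setoid

  eigenspace-sub : ∀ {n} {A : Matrix ℝ n} {μ v w} c → v ∈ Eigenspace ℝ A μ → w ∈ Eigenspace ℝ A μ →
    (λ j → w j - c * v j) ∈ Eigenspace ℝ A μ
  eigenspace-sub {A = A} {μ} {v} {w} c v∈E w∈E i = begin
    sum (λ j → A i j * (w j - c * v j))
      ≈⟨ sum-cong-≋ (λ j → solve 4 (λ a w c v → a :* (w :- c :* v) := a :* w :+ :- c :* (a :* v))
           refl (A i j) (w j) c (v j)) ⟩
    sum (λ j → A i j * w j + - c * (A i j * v j))
      ≈⟨ ∑-distrib-+ (λ j → A i j * w j) (λ j → - c * (A i j * v j)) ⟩
    sum (λ j → A i j * w j) + sum (λ j → - c * (A i j * v j))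
      ≈⟨ +-cong (w∈E i) (sym (*-distribˡ-sum (- c) (λ j → A i j * v j))) ⟩
    μ * w i + - c * sum (λ j → A i j * v j)
      ≈⟨ +-congˡ (*-congˡ (v∈E i)) ⟩
    μ * w i + - c * (μ * v i)
      ≈⟨ solve 4 (λ μ w c v → μ :* w :+ :- c :* (μ :* v) := μ :* (w :- c :* v)) refl μ (w i) c (v i) ⟩
    μ * (w i - c * v i)  ∎

  -- Subtracting w i / v i times `v` from an eigenvector `w` clears its coordinate `i`, and the last
  -- hypothesis then makes the difference zero.
  eigenline : ∀ {n} {A : Matrix ℝ n} {μ v} i → v ∈ Eigenspace ℝ A μ → ¬ v i ≈ 0# →
    (∀ w → w ∈ Eigenspace ℝ A μ → w i ≈ 0# → ∀ j → w j ≈ 0#) →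
    HasMultiplicity ℝ A μ 1
  eigenline {v = v} i v∈E vi≉0 injective = (λ _ → v) , record
    { members     = λ _ → v∈E
    ; independent = λ { c cv≈0 zero → *-cancel-0 vi≉0
        (trans (*-comm (v i) (c 0F)) (trans (sym (+-identityʳ _)) (cv≈0 i))) }
    ; spanning    = λ w w∈E → let c = w i * v⁻¹ in (λ _ → c) , λ j → trans
        (-≈0⇒≈ (injective (λ j → w j - c * v j) (eigenspace-sub c v∈E w∈E)
          (trans (solve 3 (λ w v v⁻¹ → w :- w :* v⁻¹ :* v := w :* (con (+ 1) :- v :* v⁻¹)) refl (w i) (v i) v⁻¹)
            (*-zeroʳ (w i) (≈⇒-≈0 (sym vv⁻¹≈1)))) j))
        (sym (+-identityʳ _))
    }
    where
    v⁻¹ = proj₁ (inverse (v i) vi≉0)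
    vv⁻¹≈1 = proj₂ (inverse (v i) vi≉0)

  multiplicity⇒isEigenvalue : ∀ {n} {A : Matrix ℝ n} {μ m} →
    HasMultiplicity ℝ A μ (suc m) → IsEigenvalue ℝ A μ
  multiplicity⇒isEigenvalue {m = m} (b , B) = b zero , members zero , λ b₀≈0 →
    0≉1 (sym (independent δ (λ i → trans (+-cong (*-zeroʳ 1# (b₀≈0 i)) (sum-0 {m} (λ k → zeroˡ (b (suc k) i))))
      (+-identityˡ 0#)) zero))
    where
    open IsBasis B
    δ : Vector Carrier (suc m)
    δ zero    = 1#
    δ (suc _) = 0#

-- Spectra of arrowhead matrices

module Arrowheads (ℝ : Reals) where
  open Reals ℝ hiding (zero)
  open OrderedField ℝ
  open LinearAlgebra ℝ
  open Cubics ℝ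
  open Eigenlines ℝ
  open IntegerCoefficients commutativeRing
    using (Polynomial; solve; con; _:=_; _:+_; _:*_; :-_; _:-_)

  arrowhead : (P Q y z : Carrier) → Matrix ℝ 4
  arrowhead P Q y z =
    (0# ∷ᵛ 0# ∷ᵛ 0# ∷ᵛ 0#    ∷ᵛ []ᵛ) ∷ᵛ
    (0# ∷ᵛ P  ∷ᵛ 0# ∷ᵛ y     ∷ᵛ []ᵛ) ∷ᵛ
    (0# ∷ᵛ 0# ∷ᵛ Q  ∷ᵛ z     ∷ᵛ []ᵛ) ∷ᵛ
    (0# ∷ᵛ y  ∷ᵛ z  ∷ᵛ P + Q ∷ᵛ []ᵛ) ∷ᵛ []ᵛ

  -- The nesting and the trailing zero copy how `sum` unfolds over four indices, so that solver
  -- identities apply to matrix products directly.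
  row : ∀ {n} → (a b c d s t u v : Polynomial n) → Polynomial n
  row a b c d s t u v = a :* s :+ (b :* t :+ (c :* u :+ (d :* v :+ con (+ 0))))

  -- The equation (μ - M) v = 0 by rows. With zero on the right, eliminations are linear
  -- combinations of the fields.
  record Equations (P Q y z μ : Carrier) (v : Vector Carrier 4) : Set where
    constructor equations
    field
      eq₀ : μ * v 0F ≈ 0#
      eq₁ : (μ - P) * v 1F - y * v 3F ≈ 0#
      eq₂ : (μ - Q) * v 2F - z * v 3F ≈ 0#
      eq₃ : (μ - (P + Q)) * v 3F - y * v 1F - z * v 2F ≈ 0#

  module _ {P Q y z : Carrier} where
    private
      M = arrowhead P Q y z

      residual₀ : ∀ μ v → μ * v 0F ≈ μ * v 0F - (M · v) 0F
      residual₀ μ v = solve 5 (λ μ s t u v → μ :* s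
          := μ :* s :- row (con (+ 0)) (con (+ 0)) (con (+ 0)) (con (+ 0)) s t u v)
        refl μ (v 0F) (v 1F) (v 2F) (v 3F)

      residual₁ : ∀ μ v → (μ - P) * v 1F - y * v 3F ≈ μ * v 1F - (M · v) 1F
      residual₁ μ v = solve 7 (λ P y μ s t u v → (μ :- P) :* t :- y :* v
          := μ :* t :- row (con (+ 0)) P (con (+ 0)) y s t u v)
        refl P y μ (v 0F) (v 1F) (v 2F) (v 3F)

      residual₂ : ∀ μ v → (μ - Q) * v 2F - z * v 3F ≈ μ * v 2F - (M · v) 2F
      residual₂ μ v = solve 7 (λ Q z μ s t u v → (μ :- Q) :* u :- z :* v
          := μ :* u :- row (con (+ 0)) (con (+ 0)) Q z s t u v)
        refl Q z μ (v 0F) (v 1F) (v 2F) (v 3F)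

      residual₃ : ∀ μ v → (μ - (P + Q)) * v 3F - y * v 1F - z * v 2F ≈ μ * v 3F - (M · v) 3F
      residual₃ μ v = solve 8 (λ R y z μ s t u v → (μ :- R) :* v :- y :* t :- z :* u
          := μ :* v :- row (con (+ 0)) y z R s t u v)
        refl (P + Q) y z μ (v 0F) (v 1F) (v 2F) (v 3F)

    ∈-eigenspace⁻ : ∀ {μ v} → v ∈ Eigenspace ℝ M μ → Equations P Q y z μ v
    ∈-eigenspace⁻ {μ} {v} v∈E = equations
      (trans (residual₀ μ v) (≈⇒-≈0 (sym (v∈E 0F))))
      (trans (residual₁ μ v) (≈⇒-≈0 (sym (v∈E 1F))))
      (trans (residual₂ μ v) (≈⇒-≈0 (sym (v∈E 2F))))
      (trans (residual₃ μ v) (≈⇒-≈0 (sym (v∈E 3F))))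

    ∈-eigenspace⁺ : ∀ {μ v} → Equations P Q y z μ v → v ∈ Eigenspace ℝ M μ
    ∈-eigenspace⁺ {μ} {v} (equations eq₀ eq₁ eq₂ eq₃) = λ where
      0F → sym (-≈0⇒≈ (trans (sym (residual₀ μ v)) eq₀))
      1F → sym (-≈0⇒≈ (trans (sym (residual₁ μ v)) eq₁))
      2F → sym (-≈0⇒≈ (trans (sym (residual₂ μ v)) eq₂))
      3F → sym (-≈0⇒≈ (trans (sym (residual₃ μ v)) eq₃))

    χ : Carrier → Carrier
    χ = cubic (σ₁ P Q) (σ₂ P Q y z) (σ₃ P Q y z)

    -- The principal 2 × 2 minors of μ - M on the last three coordinates; their
    -- sum is the derivative of χ.
    minor₁ minor₂ minor₃ : Carrier → Carrier
    minor₁ μ = (μ - Q) * (μ - (P + Q)) - z * z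
    minor₂ μ = (μ - P) * (μ - (P + Q)) - y * y
    minor₃ μ = (μ - P) * (μ - Q)

    private
      :χ : ∀ {n} → (P Q y z x : Polynomial n) → Polynomial n
      :χ P Q y z x = x :* x :* x :- (P :+ Q :+ (P :+ Q)) :* (x :* x)
        :+ (P :* Q :+ (P :+ Q) :* (P :+ Q) :- y :* y :- z :* z) :* x
        :- (P :* Q :* (P :+ Q) :- y :* y :* Q :- z :* z :* P)

      combine : ∀ {a b c} x y z → a ≈ 0# → b ≈ 0# → c ≈ 0# → x * a + y * b + z * c ≈ 0#
      combine x y z a≈0 b≈0 c≈0 = *-zeroʳ x a≈0 ⊞ *-zeroʳ y b≈0 ⊞ *-zeroʳ z c≈0

    -- On the last three coordinates adj (μ - M) (μ - M) = χ(μ), and the multipliers of the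
    -- equations are the rows of this adjugate.
    χ-annihilates : ∀ {μ v} → v 0F ≈ 0# → Equations P Q y z μ v → ¬ χ μ ≈ 0# → ∀ i → v i ≈ 0#
    χ-annihilates v₀≈0 _ _ 0F = v₀≈0
    χ-annihilates {μ} {v} _ (equations _ eq₁ eq₂ eq₃) χ≉0 1F = *-cancel-0 χ≉0 (trans
      (solve 8 (λ P Q y z μ t u v → :χ P Q y z μ :* t
          := ((μ :- Q) :* (μ :- (P :+ Q)) :- z :* z) :* ((μ :- P) :* t :- y :* v)
             :+ y :* z :* ((μ :- Q) :* u :- z :* v)
             :+ y :* (μ :- Q) :* ((μ :- (P :+ Q)) :* v :- y :* t :- z :* u))
        refl P Q y z μ (v 1F) (v 2F) (v 3F))
      (combine (minor₁ μ) (y * z) (y * (μ - Q)) eq₁ eq₂ eq₃))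
    χ-annihilates {μ} {v} _ (equations _ eq₁ eq₂ eq₃) χ≉0 2F = *-cancel-0 χ≉0 (trans
      (solve 8 (λ P Q y z μ t u v → :χ P Q y z μ :* u
          := y :* z :* ((μ :- P) :* t :- y :* v)
             :+ ((μ :- P) :* (μ :- (P :+ Q)) :- y :* y) :* ((μ :- Q) :* u :- z :* v)
             :+ z :* (μ :- P) :* ((μ :- (P :+ Q)) :* v :- y :* t :- z :* u))
        refl P Q y z μ (v 1F) (v 2F) (v 3F))
      (combine (y * z) (minor₂ μ) (z * (μ - P)) eq₁ eq₂ eq₃))
    χ-annihilates {μ} {v} _ (equations _ eq₁ eq₂ eq₃) χ≉0 3F = *-cancel-0 χ≉0 (trans
      (solve 8 (λ P Q y z μ t u v → :χ P Q y z μ :* v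
          := y :* (μ :- Q) :* ((μ :- P) :* t :- y :* v)
             :+ z :* (μ :- P) :* ((μ :- Q) :* u :- z :* v)
             :+ (μ :- P) :* (μ :- Q) :* ((μ :- (P :+ Q)) :* v :- y :* t :- z :* u))
        refl P Q y z μ (v 1F) (v 2F) (v 3F))
      (combine (y * (μ - Q)) (z * (μ - P)) (minor₃ μ) eq₁ eq₂ eq₃))

    -- If μ is a root of χ, then the columns of the adjugate of μ - M are
    -- eigenvectors, with the principal minors on the diagonal.
    eigenline₁ : ∀ {μ} → ¬ μ ≈ 0# → χ μ ≈ 0# → ¬ minor₁ μ ≈ 0# → HasMultiplicity ℝ M μ 1
    eigenline₁ {μ} μ≉0 χ≈0 m₁≉0 = eigenline {A = M} {v = v} 1F (∈-eigenspace⁺ (equations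
        (zeroʳ μ)
        (trans (solve 5 (λ P Q y z μ → (μ :- P) :* ((μ :- Q) :* (μ :- (P :+ Q)) :- z :* z) :- y :* (y :* (μ :- Q))
                           := :χ P Q y z μ) refl P Q y z μ) χ≈0)
        (solve 4 (λ Q y z μ → (μ :- Q) :* (y :* z) :- z :* (y :* (μ :- Q)) := con (+ 0)) refl Q y z μ)
        (solve 5 (λ P Q y z μ → (μ :- (P :+ Q)) :* (y :* (μ :- Q))
                     :- y :* ((μ :- Q) :* (μ :- (P :+ Q)) :- z :* z) :- z :* (y :* z) := con (+ 0)) refl P Q y z μ)))
      m₁≉0 λ w w∈E w₁≈0 → let equations eq₀ eq₁ eq₂ eq₃ = ∈-eigenspace⁻ w∈E in λ where
        0F → *-cancel-0 μ≉0 eq₀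
        1F → w₁≈0
        -- Cramer's rule: once the first of the three coordinates is zero, the equations `eq₂` and
        -- `eq₃` form a system in the other two with determinant `minor₁ μ`.
        2F → *-cancel-0 m₁≉0 (trans
          (solve 8 (λ P Q y z μ t u v → ((μ :- Q) :* (μ :- (P :+ Q)) :- z :* z) :* u
              := (μ :- (P :+ Q)) :* ((μ :- Q) :* u :- z :* v)
                 :+ z :* ((μ :- (P :+ Q)) :* v :- y :* t :- z :* u) :+ z :* y :* t)
            refl P Q y z μ (w 1F) (w 2F) (w 3F))
          (combine (μ - (P + Q)) z (z * y) eq₂ eq₃ w₁≈0))
        3F → *-cancel-0 m₁≉0 (trans
          (solve 8 (λ P Q y z μ t u v → ((μ :- Q) :* (μ :- (P :+ Q)) :- z :* z) :* v
              := z :* ((μ :- Q) :* u :- z :* v)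
                 :+ (μ :- Q) :* ((μ :- (P :+ Q)) :* v :- y :* t :- z :* u) :+ (μ :- Q) :* y :* t)
            refl P Q y z μ (w 1F) (w 2F) (w 3F))
          (combine z (μ - Q) ((μ - Q) * y) eq₂ eq₃ w₁≈0))
      where
      v : Vector Carrier 4
      v = 0# ∷ᵛ minor₁ μ ∷ᵛ y * z ∷ᵛ y * (μ - Q) ∷ᵛ []ᵛ

    eigenline₂ : ∀ {μ} → ¬ μ ≈ 0# → χ μ ≈ 0# → ¬ minor₂ μ ≈ 0# → HasMultiplicity ℝ M μ 1
    eigenline₂ {μ} μ≉0 χ≈0 m₂≉0 = eigenline {A = M} {v = v} 2F (∈-eigenspace⁺ (equations
        (zeroʳ μ)
        (solve 4 (λ P y z μ → (μ :- P) :* (y :* z) :- y :* (z :* (μ :- P)) := con (+ 0)) refl P y z μ)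
        (trans (solve 5 (λ P Q y z μ → (μ :- Q) :* ((μ :- P) :* (μ :- (P :+ Q)) :- y :* y) :- z :* (z :* (μ :- P))
                           := :χ P Q y z μ) refl P Q y z μ) χ≈0)
        (solve 5 (λ P Q y z μ → (μ :- (P :+ Q)) :* (z :* (μ :- P))
                     :- y :* (y :* z) :- z :* ((μ :- P) :* (μ :- (P :+ Q)) :- y :* y) := con (+ 0)) refl P Q y z μ)))
      m₂≉0 λ w w∈E w₂≈0 → let equations eq₀ eq₁ eq₂ eq₃ = ∈-eigenspace⁻ w∈E in λ where
        0F → *-cancel-0 μ≉0 eq₀
        1F → *-cancel-0 m₂≉0 (trans
          (solve 8 (λ P Q y z μ t u v → ((μ :- P) :* (μ :- (P :+ Q)) :- y :* y) :* t
              := (μ :- (P :+ Q)) :* ((μ :- P) :* t :- y :* v)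
                 :+ y :* ((μ :- (P :+ Q)) :* v :- y :* t :- z :* u) :+ y :* z :* u)
            refl P Q y z μ (w 1F) (w 2F) (w 3F))
          (combine (μ - (P + Q)) y (y * z) eq₁ eq₃ w₂≈0))
        2F → w₂≈0
        3F → *-cancel-0 m₂≉0 (trans
          (solve 8 (λ P Q y z μ t u v → ((μ :- P) :* (μ :- (P :+ Q)) :- y :* y) :* v
              := y :* ((μ :- P) :* t :- y :* v)
                 :+ (μ :- P) :* ((μ :- (P :+ Q)) :* v :- y :* t :- z :* u) :+ (μ :- P) :* z :* u)
            refl P Q y z μ (w 1F) (w 2F) (w 3F))
          (combine y (μ - P) ((μ - P) * z) eq₁ eq₃ w₂≈0))
      where
      v : Vector Carrier 4
      v = 0# ∷ᵛ y * z ∷ᵛ minor₂ μ ∷ᵛ z * (μ - P) ∷ᵛ []ᵛ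

    eigenline₃ : ∀ {μ} → ¬ μ ≈ 0# → χ μ ≈ 0# → ¬ minor₃ μ ≈ 0# → HasMultiplicity ℝ M μ 1
    eigenline₃ {μ} μ≉0 χ≈0 m₃≉0 = eigenline {A = M} {v = v} 3F (∈-eigenspace⁺ (equations
        (zeroʳ μ)
        (solve 4 (λ P Q y μ → (μ :- P) :* (y :* (μ :- Q)) :- y :* ((μ :- P) :* (μ :- Q)) := con (+ 0)) refl P Q y μ)
        (solve 4 (λ P Q z μ → (μ :- Q) :* (z :* (μ :- P)) :- z :* ((μ :- P) :* (μ :- Q)) := con (+ 0)) refl P Q z μ)
        (trans (solve 5 (λ P Q y z μ → (μ :- (P :+ Q)) :* ((μ :- P) :* (μ :- Q))
                             :- y :* (y :* (μ :- Q)) :- z :* (z :* (μ :- P)) := :χ P Q y z μ) refl P Q y z μ) χ≈0)))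
      m₃≉0 λ w w∈E w₃≈0 → let equations eq₀ eq₁ eq₂ eq₃ = ∈-eigenspace⁻ w∈E in λ where
        0F → *-cancel-0 μ≉0 eq₀
        1F → *-cancel-0 m₃≉0 (trans
          (solve 5 (λ p q y t v → p :* q :* t := q :* (p :* t :- y :* v) :+ q :* y :* v)
            refl (μ - P) (μ - Q) y (w 1F) (w 3F))
          (*-zeroʳ (μ - Q) eq₁ ⊞ *-zeroʳ ((μ - Q) * y) w₃≈0))
        2F → *-cancel-0 m₃≉0 (trans
          (solve 5 (λ p q z u v → p :* q :* u := p :* (q :* u :- z :* v) :+ p :* z :* v)
            refl (μ - P) (μ - Q) z (w 2F) (w 3F))
          (*-zeroʳ (μ - P) eq₂ ⊞ *-zeroʳ ((μ - P) * z) w₃≈0))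
        3F → w₃≈0
      where
      v : Vector Carrier 4
      v = 0# ∷ᵛ y * (μ - Q) ∷ᵛ z * (μ - P) ∷ᵛ minor₃ μ ∷ᵛ []ᵛ

    simple-root : ∀ {r₁ r₂ r₃} → IsRoots (σ₁ P Q) (σ₂ P Q y z) (σ₃ P Q y z) r₁ r₂ r₃ →
      ¬ r₁ ≈ 0# → ¬ r₁ ≈ r₂ → ¬ r₁ ≈ r₃ → HasMultiplicity ℝ M r₁ 1
    simple-root {r₁} {r₂} {r₃} R@(roots e₁≈ e₂≈ e₃≈) r₁≉0 r₁≉r₂ r₁≉r₃
      with minor₁ r₁ ≟ 0# | minor₂ r₁ ≟ 0# | minor₃ r₁ ≟ 0#
    ... | no m₁≉0 | _ | _ = eigenline₁ r₁≉0 (IsRoots.root₁ R) m₁≉0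
    ... | yes _ | no m₂≉0 | _ = eigenline₂ r₁≉0 (IsRoots.root₁ R) m₂≉0
    ... | yes _ | yes _ | no m₃≉0 = eigenline₃ r₁≉0 (IsRoots.root₁ R) m₃≉0
    ... | yes m₁≈0 | yes m₂≈0 | yes m₃≈0 = contradiction derivative≈0
        (*-≉0 (λ d → r₁≉r₂ (-≈0⇒≈ d)) (λ d → r₁≉r₃ (-≈0⇒≈ d)))
      where
      derivative≈0 : (r₁ - r₂) * (r₁ - r₃) ≈ 0#
      -- By Vieta the product is 3r₁² - 2σ₁r₁ + σ₂, the derivative of χ at r₁.
      derivative≈0 = begin
        (r₁ - r₂) * (r₁ - r₃)
          ≈⟨ solve 3 (λ a b c → (a :- b) :* (a :- c)
               := a :* a :+ a :* a :+ a :* a :- ((a :+ b :+ c) :* a :+ (a :+ b :+ c) :* a)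
                  :+ (a :* b :+ a :* c :+ b :* c)) refl r₁ r₂ r₃ ⟩
        r₁ * r₁ + r₁ * r₁ + r₁ * r₁ - ((r₁ + r₂ + r₃) * r₁ + (r₁ + r₂ + r₃) * r₁)
          + (r₁ * r₂ + r₁ * r₃ + r₂ * r₃)
          ≈⟨ +-cong (+-congˡ (-‿cong (+-cong (*-congʳ e₁≈) (*-congʳ e₁≈)))) e₂≈ ⟨
        r₁ * r₁ + r₁ * r₁ + r₁ * r₁ - (σ₁ P Q * r₁ + σ₁ P Q * r₁) + σ₂ P Q y z
          ≈⟨ solve 5 (λ P Q y z x → x :* x :+ x :* x :+ x :* x
                 :- ((P :+ Q :+ (P :+ Q)) :* x :+ (P :+ Q :+ (P :+ Q)) :* x)
                 :+ (P :* Q :+ (P :+ Q) :* (P :+ Q) :- y :* y :- z :* z)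
               := ((x :- Q) :* (x :- (P :+ Q)) :- z :* z) :+ ((x :- P) :* (x :- (P :+ Q)) :- y :* y)
                  :+ (x :- P) :* (x :- Q)) refl P Q y z r₁ ⟩
        minor₁ r₁ + minor₂ r₁ + minor₃ r₁
          ≈⟨ m₁≈0 ⊞ m₂≈0 ⊞ m₃≈0 ⟩
        0#  ∎
        where open import Relation.Binary.Reasoning.Setoid setoid

    -- Since χ(0) = - σ₃, the last three coordinates of a null vector with zero leading coordinate
    -- vanish.
    zero-simple : ¬ σ₃ P Q y z ≈ 0# → HasMultiplicity ℝ M 0# 1
    zero-simple σ₃≉0 = eigenline {A = M} {v = v} 0F (∈-eigenspace⁺ (equations
        (zeroˡ 1#)
        (solve 2 (λ P y → (con (+ 0) :- P) :* con (+ 0) :- y :* con (+ 0) := con (+ 0)) refl P y)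
        (solve 2 (λ Q z → (con (+ 0) :- Q) :* con (+ 0) :- z :* con (+ 0) := con (+ 0)) refl Q z)
        (solve 3 (λ R y z → (con (+ 0) :- R) :* con (+ 0) :- y :* con (+ 0) :- z :* con (+ 0) := con (+ 0))
          refl (P + Q) y z)))
      (λ 1≈0 → 0≉1 (sym 1≈0))
      λ w w∈E w₀≈0 → χ-annihilates w₀≈0 (∈-eigenspace⁻ w∈E) χ0≉0
      where
      v : Vector Carrier 4
      v = 1# ∷ᵛ 0# ∷ᵛ 0# ∷ᵛ 0# ∷ᵛ []ᵛ
      χ0≉0 : ¬ χ 0# ≈ 0#
      χ0≉0 χ0≈0 = σ₃≉0 (trans
        (solve 3 (λ e₁ e₂ e₃ → e₃ := :- (con (+ 0) :* con (+ 0) :* con (+ 0)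
            :- e₁ :* (con (+ 0) :* con (+ 0)) :+ e₂ :* con (+ 0) :- e₃))
          refl (σ₁ P Q) (σ₂ P Q y z) (σ₃ P Q y z))
        (neg-≈0 χ0≈0))

    -- The roots may coincide, so this serves the distinct and the degenerate case alike.
    eigenvalue-cases : ∀ {r₁ r₂ r₃} → IsRoots (σ₁ P Q) (σ₂ P Q y z) (σ₃ P Q y z) r₁ r₂ r₃ →
      ∀ {μ} → IsEigenvalue ℝ M μ → μ ≈ 0# ⊎ μ ≈ r₁ ⊎ μ ≈ r₂ ⊎ μ ≈ r₃
    eigenvalue-cases R {μ} (v , v∈E , v≉0) with μ ≟ 0# | χ μ ≟ 0#
    ... | yes μ≈0 | _       = inj₁ μ≈0
    ... | no μ≉0  | no χ≉0  = contradiction (χ-annihilates (*-cancel-0 μ≉0 (Equations.eq₀ eqs)) eqs χ≉0) v≉0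
      where
      eqs : Equations P Q y z μ v
      eqs = ∈-eigenspace⁻ v∈E
    ... | no _    | yes χ≈0 = inj₂ (Sum.map -≈0⇒≈ (λ rest≈0 → Sum.map -≈0⇒≈ -≈0⇒≈ (*-zero-⊎ rest≈0))
            (*-zero-⊎ (trans (sym (IsRoots.cubic-factors R μ)) χ≈0)))

    distinct⇒1111 : DistinctSpectrum P Q y z → IsOrderedMultiplicityList ℝ M (1 ∷ 1 ∷ 1 ∷ 1 ∷ [])
    distinct⇒1111 (r₁ , r₂ , r₃ , 0<r₁ , r₁<r₂ , r₂<r₃ , R) = record
      { eigenvalue     = eigenvalue
      ; increasing     = increasing
      ; isEigenvalue   = λ i → multiplicity⇒isEigenvalue {A = M} (dimension i)
      ; exhaustive     = λ μ μ-eigenvalue → case (eigenvalue-cases R μ-eigenvalue)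
      ; multiplicities = multiplicities
      }
      where
      eigenvalue : Vector Carrier 4
      eigenvalue = 0# ∷ᵛ r₁ ∷ᵛ r₂ ∷ᵛ r₃ ∷ᵛ []ᵛ

      0<r₂ = <-trans 0<r₁ r₁<r₂
      0<r₃ = <-trans 0<r₂ r₂<r₃
      r₁<r₃ = <-trans r₁<r₂ r₂<r₃

      increasing : ∀ i j → i Fin.< j → eigenvalue i < eigenvalue j
      increasing 0F 1F _ = 0<r₁
      increasing 0F 2F _ = 0<r₂
      increasing 0F 3F _ = 0<r₃
      increasing 1F 2F _ = r₁<r₂
      increasing 1F 3F _ = r₁<r₃
      increasing 2F 3F _ = r₂<r₃
      increasing 1F 1F (s≤s ())
      increasing 2F 1F (s≤s ())
      increasing 2F 2F (s≤s (s≤s ()))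
      increasing 3F 1F (s≤s ())
      increasing 3F 2F (s≤s (s≤s ()))
      increasing 3F 3F (s≤s (s≤s (s≤s ())))

      dimension : ∀ i → HasMultiplicity ℝ M (eigenvalue i) 1
      dimension 0F = zero-simple λ σ₃≈0 → <⇒≉ (*-pos (*-pos 0<r₁ 0<r₂) 0<r₃)
        (sym (trans (sym (IsRoots.e₃≈ R)) σ₃≈0))
      dimension 1F = simple-root R (λ r₁≈0 → <⇒≉ 0<r₁ (sym r₁≈0)) (<⇒≉ r₁<r₂) (<⇒≉ r₁<r₃)
      dimension 2F = simple-root (IsRoots-swap₁₂ R) (λ r₂≈0 → <⇒≉ 0<r₂ (sym r₂≈0))
        (λ r₂≈r₁ → <⇒≉ r₁<r₂ (sym r₂≈r₁)) (<⇒≉ r₂<r₃)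
      dimension 3F = simple-root (IsRoots-swap₁₃ R) (λ r₃≈0 → <⇒≉ 0<r₃ (sym r₃≈0))
        (λ r₃≈r₂ → <⇒≉ r₂<r₃ (sym r₃≈r₂)) (λ r₃≈r₁ → <⇒≉ r₁<r₃ (sym r₃≈r₁))

      multiplicities : ∀ i → HasMultiplicity ℝ M (eigenvalue i) (lookup (1 ∷ 1 ∷ 1 ∷ 1 ∷ []) i)
      multiplicities 0F = dimension 0F
      multiplicities 1F = dimension 1F
      multiplicities 2F = dimension 2F
      multiplicities 3F = dimension 3F

      case : ∀ {μ} → μ ≈ 0# ⊎ μ ≈ r₁ ⊎ μ ≈ r₂ ⊎ μ ≈ r₃ → ∃[ i ] μ ≈ eigenvalue i
      case (inj₁ μ≈0)                = 0F , μ≈0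
      case (inj₂ (inj₁ μ≈r₁))        = 1F , μ≈r₁
      case (inj₂ (inj₂ (inj₁ μ≈r₂))) = 2F , μ≈r₂
      case (inj₂ (inj₂ (inj₂ μ≈r₃))) = 3F , μ≈r₃

    module _ (0<P : 0# < P) (0<Q : 0# < Q) (degenerate : Degenerate P Q y z) where
      private
        y≈0 = proj₁ degenerate
        z²≈ = proj₂ degenerate

      degenerate-roots : IsRoots (σ₁ P Q) (σ₂ P Q y z) (σ₃ P Q y z) P P (Q + Q)
      degenerate-roots = roots
        (solve 2 (λ P Q → P :+ Q :+ (P :+ Q) := P :+ P :+ (Q :+ Q)) refl P Q)
        (-≈0⇒≈ (trans
          (solve 4 (λ P Q y z → P :* Q :+ (P :+ Q) :* (P :+ Q) :- y :* y :- z :* z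
              :- (P :* P :+ P :* (Q :+ Q) :+ P :* (Q :+ Q)) := :- y :* y :+ :- (z :* z :- Q :* (Q :- P)))
            refl P Q y z)
          (*-zeroʳ (- y) y≈0 ⊞ neg-≈0 (≈⇒-≈0 z²≈))))
        (-≈0⇒≈ (trans
          (solve 4 (λ P Q y z → P :* Q :* (P :+ Q) :- y :* y :* Q :- z :* z :* P :- P :* P :* (Q :+ Q)
              := :- (y :* Q) :* y :+ :- P :* (z :* z :- Q :* (Q :- P)))
            refl P Q y z)
          (*-zeroʳ (- (y * Q)) y≈0 ⊞ *-zeroʳ (- P) (≈⇒-≈0 z²≈))))

      -- Adding Q² to z² = Q (Q - P) ≥ 0 gives Q (2Q - P) > 0.
      P<2Q : P < Q + Q
      P<2Q = 0<-⇒< (*-pos-cancelˡ (<⇒≤ 0<Q) (0<-resp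
        (trans (+-congˡ z²≈) (solve 2 (λ P Q → Q :* Q :+ Q :* (Q :- P) := Q :* (Q :+ Q :- P)) refl P Q))
        (+-pos-nonNeg (*-pos 0<Q 0<Q) (sq-nonNeg z))))

      double-root : HasMultiplicity ℝ M P 2
      double-root = b , record
        { members = λ where
            0F → ∈-eigenspace⁺ (equations (zeroʳ P)
              (solve 2 (λ P y → (P :- P) :* con (+ 1) :- y :* con (+ 0) := con (+ 0)) refl P y)
              (solve 3 (λ P Q z → (P :- Q) :* con (+ 0) :- z :* con (+ 0) := con (+ 0)) refl P Q z)
              (trans (solve 4 (λ P Q y z → (P :- (P :+ Q)) :* con (+ 0) :- y :* con (+ 1) :- z :* con (+ 0) := :- y)
                refl P Q y z) (neg-≈0 y≈0)))
            1F → ∈-eigenspace⁺ (equations (zeroʳ P)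
              (trans (solve 3 (λ P y z → (P :- P) :* con (+ 0) :- y :* (:- z) := z :* y) refl P y z) (*-zeroʳ z y≈0))
              (trans (solve 3 (λ P Q z → (P :- Q) :* Q :- z :* (:- z) := z :* z :- Q :* (Q :- P)) refl P Q z)
                (≈⇒-≈0 z²≈))
              (solve 4 (λ P Q y z → (P :- (P :+ Q)) :* (:- z) :- y :* con (+ 0) :- z :* Q := con (+ 0))
                refl P Q y z))
        ; independent = λ c cb≈0 → λ where
            0F → trans (solve 2 (λ c d → c := c :* con (+ 1) :+ (d :* con (+ 0) :+ con (+ 0))) refl (c 0F) (c 1F))
                   (cb≈0 1F)
            1F → *-cancel-0 Q≉0 (trans
                   (solve 3 (λ c d Q → Q :* d := c :* con (+ 0) :+ (d :* Q :+ con (+ 0))) refl (c 0F) (c 1F) Q)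
                   (cb≈0 2F))
        ; spanning = λ v v∈E → let equations eq₀ eq₁ eq₂ eq₃ = ∈-eigenspace⁻ v∈E in
            (v 1F ∷ᵛ v 2F * Q⁻¹ ∷ᵛ []ᵛ) , λ where
              0F → trans (*-cancel-0 P≉0 eq₀)
                (solve 2 (λ c d → con (+ 0) := c :* con (+ 0) :+ (d :* con (+ 0) :+ con (+ 0)))
                  refl (v 1F) (v 2F * Q⁻¹))
              1F → solve 2 (λ c d → c := c :* con (+ 1) :+ (d :* con (+ 0) :+ con (+ 0)))
                refl (v 1F) (v 2F * Q⁻¹)
              2F → -≈0⇒≈ (trans
                (solve 4 (λ t u Q Q⁻¹ → u :- (t :* con (+ 0) :+ (u :* Q⁻¹ :* Q :+ con (+ 0)))
                    := :- u :* (Q :* Q⁻¹ :- con (+ 1))) refl (v 1F) (v 2F) Q Q⁻¹)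
                (*-zeroʳ (- v 2F) (≈⇒-≈0 QQ⁻¹≈1)))
              -- With y = 0 the last equation reads Q v₃ = - z v₂, so this coordinate is determined
              -- by the previous one.
              3F → -≈0⇒≈ (*-cancel-0 Q≉0 (trans
                (solve 8 (λ P Q y z Q⁻¹ t u v →
                    Q :* (v :- (t :* con (+ 0) :+ (u :* Q⁻¹ :* (:- z) :+ con (+ 0))))
                    := :- ((P :- (P :+ Q)) :* v :- y :* t :- z :* u) :+ :- t :* y
                       :+ u :* z :* (Q :* Q⁻¹ :- con (+ 1)))
                  refl P Q y z Q⁻¹ (v 1F) (v 2F) (v 3F))
                (neg-≈0 eq₃ ⊞ *-zeroʳ (- v 1F) y≈0 ⊞ *-zeroʳ (v 2F * z) (≈⇒-≈0 QQ⁻¹≈1))))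
        }
        where
        P≉0 : ¬ P ≈ 0#
        P≉0 P≈0 = <⇒≉ 0<P (sym P≈0)
        Q≉0 : ¬ Q ≈ 0#
        Q≉0 Q≈0 = <⇒≉ 0<Q (sym Q≈0)
        Q⁻¹ = proj₁ (inverse Q Q≉0)
        QQ⁻¹≈1 = proj₂ (inverse Q Q≉0)
        -- The first vector is an eigenvector because y = 0. The second spans the kernel of the
        -- block with rows (P - Q, -z), (-z, -Q), which is singular exactly when z² = Q (Q - P).
        b : Vector (Vector Carrier 4) 2
        b = (0# ∷ᵛ 1# ∷ᵛ 0# ∷ᵛ 0#  ∷ᵛ []ᵛ) ∷ᵛ
            (0# ∷ᵛ 0# ∷ᵛ Q  ∷ᵛ - z ∷ᵛ []ᵛ) ∷ᵛ []ᵛ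

      degenerate⇒121 : IsOrderedMultiplicityList ℝ M (1 ∷ 2 ∷ 1 ∷ [])
      degenerate⇒121 = record
        { eigenvalue     = eigenvalue
        ; increasing     = increasing
        ; isEigenvalue   = λ where
            0F → multiplicity⇒isEigenvalue {A = M} (multiplicities 0F)
            1F → multiplicity⇒isEigenvalue {A = M} (multiplicities 1F)
            2F → multiplicity⇒isEigenvalue {A = M} (multiplicities 2F)
        ; exhaustive     = λ μ μ-eigenvalue → case (eigenvalue-cases degenerate-roots μ-eigenvalue)
        ; multiplicities = multiplicities
        }
        where
        0<2Q = +-pos 0<Q 0<Q

        eigenvalue : Vector Carrier 3
        eigenvalue = 0# ∷ᵛ P ∷ᵛ Q + Q ∷ᵛ []ᵛ

        increasing : ∀ i j → i Fin.< j → eigenvalue i < eigenvalue j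
        increasing 0F 1F _ = 0<P
        increasing 0F 2F _ = 0<2Q
        increasing 1F 2F _ = P<2Q
        increasing 1F 1F (s≤s ())
        increasing 2F 1F (s≤s ())
        increasing 2F 2F (s≤s (s≤s ()))

        multiplicities : ∀ i → HasMultiplicity ℝ M (eigenvalue i) (lookup (1 ∷ 2 ∷ 1 ∷ []) i)
        multiplicities 0F = zero-simple λ σ₃≈0 → <⇒≉ (*-pos (*-pos 0<P 0<P) 0<2Q)
          (sym (trans (sym (IsRoots.e₃≈ degenerate-roots)) σ₃≈0))
        multiplicities 1F = double-root
        multiplicities 2F = simple-root (IsRoots-swap₁₃ degenerate-roots) (λ 2Q≈0 → <⇒≉ 0<2Q (sym 2Q≈0))
          (λ 2Q≈P → <⇒≉ P<2Q (sym 2Q≈P)) (λ 2Q≈P → <⇒≉ P<2Q (sym 2Q≈P))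

        case : ∀ {μ} → μ ≈ 0# ⊎ μ ≈ P ⊎ μ ≈ P ⊎ μ ≈ Q + Q → ∃[ i ] μ ≈ eigenvalue i
        case (inj₁ μ≈0)                = 0F , μ≈0
        case (inj₂ (inj₁ μ≈P))         = 1F , μ≈P
        case (inj₂ (inj₂ (inj₁ μ≈P)))  = 1F , μ≈P
        case (inj₂ (inj₂ (inj₂ μ≈2Q))) = 2F , μ≈2Q

-- Weighted Laplacians of the four-cycle

module FourCycle (ℝ : Reals) where
  open Reals ℝ hiding (zero)
  open OrderedField ℝ
  open LinearAlgebra ℝ
  open Cubics ℝ
  open Arrowheads ℝ
  open IntegerCoefficients commutativeRing
    using (Polynomial; solve; con; _:=_; _:+_; _:*_; :-_; _:-_)
  open import Algebra.Properties.Semiring.Sum semiring using (sum-cong-≋)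
  open import Algebra.Properties.Ring ring using (-‿involutive)

  laplacian : (a b c d : Carrier) → Matrix ℝ 4
  laplacian a b c d =
    (a + d ∷ᵛ - a   ∷ᵛ 0#    ∷ᵛ - d   ∷ᵛ []ᵛ) ∷ᵛ
    (- a   ∷ᵛ a + b ∷ᵛ - b   ∷ᵛ 0#    ∷ᵛ []ᵛ) ∷ᵛ
    (0#    ∷ᵛ - b   ∷ᵛ b + c ∷ᵛ - c   ∷ᵛ []ᵛ) ∷ᵛ
    (- d   ∷ᵛ 0#    ∷ᵛ - c   ∷ᵛ c + d ∷ᵛ []ᵛ) ∷ᵛ []ᵛ

  -- The columns are ordered so that the matrix is symmetric with square 4. Column 1 changes sign
  -- across the edges of weight b and d, column 2 across those of weight a and c, column 3 across
  -- all four. This yields the diagonal P, Q, P + Q, and the zero entry since columns 1 and 2 change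
  -- sign on disjoint edge sets.
  hadamard : Matrix ℝ 4
  hadamard =
    (1# ∷ᵛ 1#   ∷ᵛ 1#   ∷ᵛ 1#   ∷ᵛ []ᵛ) ∷ᵛ
    (1# ∷ᵛ 1#   ∷ᵛ - 1# ∷ᵛ - 1# ∷ᵛ []ᵛ) ∷ᵛ
    (1# ∷ᵛ - 1# ∷ᵛ - 1# ∷ᵛ 1#   ∷ᵛ []ᵛ) ∷ᵛ
    (1# ∷ᵛ - 1# ∷ᵛ 1#   ∷ᵛ - 1# ∷ᵛ []ᵛ) ∷ᵛ []ᵛ

  transposition : Matrix ℝ 4
  transposition =
    (1# ∷ᵛ 0# ∷ᵛ 0# ∷ᵛ 0# ∷ᵛ []ᵛ) ∷ᵛ
    (0# ∷ᵛ 0# ∷ᵛ 1# ∷ᵛ 0# ∷ᵛ []ᵛ) ∷ᵛ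
    (0# ∷ᵛ 1# ∷ᵛ 0# ∷ᵛ 0# ∷ᵛ []ᵛ) ∷ᵛ
    (0# ∷ᵛ 0# ∷ᵛ 0# ∷ᵛ 1# ∷ᵛ []ᵛ) ∷ᵛ []ᵛ

  module _ {n : ℕ} where
    :0 :1 : Polynomial n
    :0 = con (+ 0)
    :1 = con (+ 1)

    :h₀ :h₁ :h₂ :h₃ :t₀ :t₁ :t₂ :t₃ : (s t u v : Polynomial n) → Polynomial n
    :h₀ = row :1 :1 :1 :1
    :h₁ = row :1 :1 (:- :1) (:- :1)
    :h₂ = row :1 (:- :1) (:- :1) :1
    :h₃ = row :1 (:- :1) :1 (:- :1)
    :t₀ = row :1 :0 :0 :0
    :t₁ = row :0 :0 :1 :0
    :t₂ = row :0 :1 :0 :0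
    :t₃ = row :0 :0 :0 :1

    -- Composition of a linear form with a matrix given by its four rows; it builds the solver terms
    -- for nested products.
    on : (f₀ f₁ f₂ f₃ : (s t u v : Polynomial n) → Polynomial n) →
      (f : (s t u v : Polynomial n) → Polynomial n) → (s t u v : Polynomial n) → Polynomial n
    on f₀ f₁ f₂ f₃ f s t u v = f (f₀ s t u v) (f₁ s t u v) (f₂ s t u v) (f₃ s t u v)

    :H :T : (f : (s t u v : Polynomial n) → Polynomial n) → (s t u v : Polynomial n) → Polynomial n
    :H = on :h₀ :h₁ :h₂ :h₃
    :T = on :t₀ :t₁ :t₂ :t₃

    :M : (P Q y z : Polynomial n) →
      (f : (s t u v : Polynomial n) → Polynomial n) → (s t u v : Polynomial n) → Polynomial n
    :M P Q y z = on (row :0 :0 :0 :0) (row :0 P :0 y) (row :0 :0 Q z) (row :0 y z (P :+ Q))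

  4≉0 : ¬ 1# + 1# + 1# + 1# ≈ 0#
  4≉0 4≈0 = <⇒≉ (+-pos (+-pos (+-pos 0<1 0<1) 0<1) 0<1) (sym 4≈0)

  hadamard² : ∀ v i → (hadamard · hadamard · v) i ≈ (1# + 1# + 1# + 1#) * v i
  hadamard² v 0F = solve 4 (λ s t u v → :H :h₀ s t u v := (:1 :+ :1 :+ :1 :+ :1) :* s)
    refl (v 0F) (v 1F) (v 2F) (v 3F)
  hadamard² v 1F = solve 4 (λ s t u v → :H :h₁ s t u v := (:1 :+ :1 :+ :1 :+ :1) :* t)
    refl (v 0F) (v 1F) (v 2F) (v 3F)
  hadamard² v 2F = solve 4 (λ s t u v → :H :h₂ s t u v := (:1 :+ :1 :+ :1 :+ :1) :* u)
    refl (v 0F) (v 1F) (v 2F) (v 3F)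
  hadamard² v 3F = solve 4 (λ s t u v → :H :h₃ s t u v := (:1 :+ :1 :+ :1 :+ :1) :* v)
    refl (v 0F) (v 1F) (v 2F) (v 3F)

  module _ (a b c d : Carrier) where

    laplacian-hadamard : ∀ v i → (laplacian a b c d · hadamard · v) i ≈
      (hadamard · arrowhead (b + d) (a + c) (d - b) (a - c) · v) i
    laplacian-hadamard v 0F = solve 8 (λ a b c d s t u v →
        :H (row (a :+ d) (:- a) :0 (:- d)) s t u v
          := :M (b :+ d) (a :+ c) (d :- b) (a :- c) :h₀ s t u v)
      refl a b c d (v 0F) (v 1F) (v 2F) (v 3F)
    laplacian-hadamard v 1F = solve 8 (λ a b c d s t u v →
        :H (row (:- a) (a :+ b) (:- b) :0) s t u v
          := :M (b :+ d) (a :+ c) (d :- b) (a :- c) :h₁ s t u v)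
      refl a b c d (v 0F) (v 1F) (v 2F) (v 3F)
    laplacian-hadamard v 2F = solve 8 (λ a b c d s t u v →
        :H (row :0 (:- b) (b :+ c) (:- c)) s t u v
          := :M (b :+ d) (a :+ c) (d :- b) (a :- c) :h₂ s t u v)
      refl a b c d (v 0F) (v 1F) (v 2F) (v 3F)
    laplacian-hadamard v 3F = solve 8 (λ a b c d s t u v →
        :H (row (:- d) :0 (:- c) (c :+ d)) s t u v
          := :M (b :+ d) (a :+ c) (d :- b) (a :- c) :h₃ s t u v)
      refl a b c d (v 0F) (v 1F) (v 2F) (v 3F)

  -- Exchanging the two middle coordinates conjugates one arrowhead matrix into the other. It
  -- reduces the second degenerate case to the first.
  arrowhead-swap : ∀ {P Q y z ms} → IsOrderedMultiplicityList ℝ (arrowhead Q P z y) ms →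
    IsOrderedMultiplicityList ℝ (arrowhead P Q y z) ms
  arrowhead-swap {P} {Q} {y} {z} = similar
    {A = arrowhead P Q y z} {M = arrowhead Q P z y} {S = transposition} (λ 1≈0 → 0≉1 (sym 1≈0)) involutive intertwines
    where
    involutive : ∀ v i → (transposition · transposition · v) i ≈ 1# * v i
    involutive v 0F = solve 4 (λ s t u v → :T :t₀ s t u v := :1 :* s) refl (v 0F) (v 1F) (v 2F) (v 3F)
    involutive v 1F = solve 4 (λ s t u v → :T :t₁ s t u v := :1 :* t) refl (v 0F) (v 1F) (v 2F) (v 3F)
    involutive v 2F = solve 4 (λ s t u v → :T :t₂ s t u v := :1 :* u) refl (v 0F) (v 1F) (v 2F) (v 3F)
    involutive v 3F = solve 4 (λ s t u v → :T :t₃ s t u v := :1 :* v) refl (v 0F) (v 1F) (v 2F) (v 3F)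

    intertwines : ∀ v i → (arrowhead P Q y z · transposition · v) i ≈
      (transposition · arrowhead Q P z y · v) i
    intertwines v 0F = solve 8 (λ P Q y z s t u v →
        :T (row :0 :0 :0 :0) s t u v := :M Q P z y :t₀ s t u v) refl P Q y z (v 0F) (v 1F) (v 2F) (v 3F)
    intertwines v 1F = solve 8 (λ P Q y z s t u v →
        :T (row :0 P :0 y) s t u v := :M Q P z y :t₁ s t u v) refl P Q y z (v 0F) (v 1F) (v 2F) (v 3F)
    intertwines v 2F = solve 8 (λ P Q y z s t u v →
        :T (row :0 :0 Q z) s t u v := :M Q P z y :t₂ s t u v) refl P Q y z (v 0F) (v 1F) (v 2F) (v 3F)
    intertwines v 3F = solve 8 (λ P Q y z s t u v →
        :T (row :0 y z (P :+ Q)) s t u v := :M Q P z y :t₃ s t u v) refl P Q y z (v 0F) (v 1F) (v 2F) (v 3F)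

  laplacian-similar : ∀ {A ms} a b c d → (∀ i j → A i j ≈ laplacian a b c d i j) →
    IsOrderedMultiplicityList ℝ (arrowhead (b + d) (a + c) (d - b) (a - c)) ms →
    IsOrderedMultiplicityList ℝ A ms
  laplacian-similar {A} a b c d A≈L = similar
    {A = A} {M = arrowhead (b + d) (a + c) (d - b) (a - c)} {S = hadamard} 4≉0 hadamard² λ v i → trans
    (sum-cong-≋ (λ j → *-congʳ {(hadamard · v) j} (A≈L i j))) (laplacian-hadamard a b c d v i)

  module _ {A : Matrix ℝ 4} (A∈𝒮ᴸ : 𝒮ᴸ ℝ C₄ A) where
    open 𝒮ᴸ A∈𝒮ᴸ
    private
      a = - A 0F 1F
      b = - A 1F 2F
      c = - A 2F 3F
      d = - A 3F 0F

      0<a : 0# < a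
      0<a = 0<-neg (edge 0F 1F (inj₁ ≡.refl))
      0<b : 0# < b
      0<b = 0<-neg (edge 1F 2F (inj₁ ≡.refl))
      0<c : 0# < c
      0<c = 0<-neg (edge 2F 3F (inj₁ ≡.refl))
      0<d : 0# < d
      0<d = 0<-neg (edge 3F 0F (inj₁ ≡.refl))

      A₀₂≈0 : A 0F 2F ≈ 0#
      A₀₂≈0 = nonEdge 0F 2F (λ ()) λ { (inj₁ ()) ; (inj₂ ()) }
      A₁₃≈0 : A 1F 3F ≈ 0#
      A₁₃≈0 = nonEdge 1F 3F (λ ()) λ { (inj₁ ()) ; (inj₂ ()) }

      :sum : ∀ {n} → (s t u v : Polynomial n) → Polynomial n
      :sum s t u v = s :+ (t :+ (u :+ (v :+ :0)))

      -sum-cong : ∀ {s t u v s′ t′ u′ v′} → s ≈ s′ → t ≈ t′ → u ≈ u′ → v ≈ v′ →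
        - (s + (t + (u + (v + 0#)))) ≈ - (s′ + (t′ + (u′ + (v′ + 0#))))
      -sum-cong s≈ t≈ u≈ v≈ = -‿cong (+-cong s≈ (+-cong t≈ (+-cong u≈ (+-congʳ v≈))))

      A≈laplacian : ∀ i j → A i j ≈ laplacian a b c d i j
      A≈laplacian 0F 0F = trans (diagonal 0F) (trans
        (-sum-cong refl refl A₀₂≈0 (symmetric 0F 3F))
        (solve 2 (λ a d → :- :sum :0 a :0 d := :- a :+ :- d) refl (A 0F 1F) (A 3F 0F)))
      A≈laplacian 1F 1F = trans (diagonal 1F) (trans
        (-sum-cong (symmetric 1F 0F) refl refl A₁₃≈0)
        (solve 2 (λ a b → :- :sum a :0 b :0 := :- a :+ :- b) refl (A 0F 1F) (A 1F 2F)))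
      A≈laplacian 2F 2F = trans (diagonal 2F) (trans
        (-sum-cong (trans (symmetric 2F 0F) A₀₂≈0) (symmetric 2F 1F) refl refl)
        (solve 2 (λ b c → :- :sum :0 b :0 c := :- b :+ :- c) refl (A 1F 2F) (A 2F 3F)))
      A≈laplacian 3F 3F = trans (diagonal 3F) (trans
        (-sum-cong refl (trans (symmetric 3F 1F) A₁₃≈0) (symmetric 3F 2F) refl)
        (solve 2 (λ c d → :- :sum d :0 c :0 := :- c :+ :- d) refl (A 2F 3F) (A 3F 0F)))
      A≈laplacian 0F 1F = sym (-‿involutive _)
      A≈laplacian 1F 2F = sym (-‿involutive _)
      A≈laplacian 2F 3F = sym (-‿involutive _)
      A≈laplacian 3F 0F = sym (-‿involutive _)
      A≈laplacian 1F 0F = trans (symmetric 1F 0F) (sym (-‿involutive _))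
      A≈laplacian 2F 1F = trans (symmetric 2F 1F) (sym (-‿involutive _))
      A≈laplacian 3F 2F = trans (symmetric 3F 2F) (sym (-‿involutive _))
      A≈laplacian 0F 3F = trans (symmetric 0F 3F) (sym (-‿involutive _))
      A≈laplacian 0F 2F = A₀₂≈0
      A≈laplacian 1F 3F = A₁₃≈0
      A≈laplacian 2F 0F = trans (symmetric 2F 0F) A₀₂≈0
      A≈laplacian 3F 1F = trans (symmetric 3F 1F) A₁₃≈0

      -- These are the gaps P² - y² = 4bd and Q² - z² = 4ac.
      0<4xy : ∀ {x y} → 0# < x → 0# < y → 0# < x * y + x * y + x * y + x * y
      0<4xy 0<x 0<y = +-pos (+-pos (+-pos 0<xy 0<xy) 0<xy) 0<xy
        where 0<xy = *-pos 0<x 0<y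

      0<P = +-pos 0<b 0<d
      0<Q = +-pos 0<a 0<c

    classification : IsOrderedMultiplicityList ℝ A (1 ∷ 1 ∷ 1 ∷ 1 ∷ []) ⊎
                     IsOrderedMultiplicityList ℝ A (1 ∷ 2 ∷ 1 ∷ [])
    classification = Sum.map
      (λ distinct → laplacian-similar a b c d A≈laplacian (distinct⇒1111 distinct))
      (λ degenerate → laplacian-similar a b c d A≈laplacian
        (Sum.[ degenerate⇒121 0<P 0<Q , (λ degenerate′ → arrowhead-swap (degenerate⇒121 0<Q 0<P degenerate′)) ]′
          degenerate))
      (spectrum 0<P 0<Q
        (0<-resp (solve 2 (λ b d → b :* d :+ b :* d :+ b :* d :+ b :* d
            := (b :+ d) :* (b :+ d) :- (d :- b) :* (d :- b)) refl b d) (0<4xy 0<b 0<d))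
        (0<-resp (solve 2 (λ a c → a :* c :+ a :* c :+ a :* c :+ a :* c
            := (a :+ c) :* (a :+ c) :- (a :- c) :* (a :- c)) refl a c) (0<4xy 0<a 0<c)))

  laplacian∈𝒮ᴸ : ∀ {a b c d} → 0# < a → 0# < b → 0# < c → 0# < d → 𝒮ᴸ ℝ C₄ (laplacian a b c d)
  laplacian∈𝒮ᴸ {a} {b} {c} {d} 0<a 0<b 0<c 0<d = record
    { symmetric = symmetric
    ; edge      = edge
    ; nonEdge   = nonEdge
    ; diagonal  = diagonal
    }
    where
    L = laplacian a b c d

    symmetric : ∀ i j → L i j ≈ L j i
    symmetric 0F 0F = refl
    symmetric 0F 1F = refl
    symmetric 0F 2F = refl
    symmetric 0F 3F = refl
    symmetric 1F 0F = refl
    symmetric 1F 1F = refl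
    symmetric 1F 2F = refl
    symmetric 1F 3F = refl
    symmetric 2F 0F = refl
    symmetric 2F 1F = refl
    symmetric 2F 2F = refl
    symmetric 2F 3F = refl
    symmetric 3F 0F = refl
    symmetric 3F 1F = refl
    symmetric 3F 2F = refl
    symmetric 3F 3F = refl

    edge : ∀ i j → SimpleGraph.Adj C₄ i j → L i j < 0#
    edge 0F 1F _ = neg<0 0<a
    edge 1F 0F _ = neg<0 0<a
    edge 1F 2F _ = neg<0 0<b
    edge 2F 1F _ = neg<0 0<b
    edge 2F 3F _ = neg<0 0<c
    edge 3F 2F _ = neg<0 0<c
    edge 3F 0F _ = neg<0 0<d
    edge 0F 3F _ = neg<0 0<d
    edge 0F 0F i~i = contradiction i~i (SimpleGraph.irrefl C₄ {0F})
    edge 1F 1F i~i = contradiction i~i (SimpleGraph.irrefl C₄ {1F})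
    edge 2F 2F i~i = contradiction i~i (SimpleGraph.irrefl C₄ {2F})
    edge 3F 3F i~i = contradiction i~i (SimpleGraph.irrefl C₄ {3F})
    edge 0F 2F (inj₁ ())
    edge 0F 2F (inj₂ ())
    edge 1F 3F (inj₁ ())
    edge 1F 3F (inj₂ ())
    edge 2F 0F (inj₁ ())
    edge 2F 0F (inj₂ ())
    edge 3F 1F (inj₁ ())
    edge 3F 1F (inj₂ ())

    nonEdge : ∀ i j → i ≢ j → ¬ SimpleGraph.Adj C₄ i j → L i j ≈ 0#
    nonEdge 0F 2F _ _ = refl
    nonEdge 2F 0F _ _ = refl
    nonEdge 1F 3F _ _ = refl
    nonEdge 3F 1F _ _ = refl
    nonEdge 0F 0F i≢i _ = contradiction ≡.refl i≢i
    nonEdge 1F 1F i≢i _ = contradiction ≡.refl i≢i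
    nonEdge 2F 2F i≢i _ = contradiction ≡.refl i≢i
    nonEdge 3F 3F i≢i _ = contradiction ≡.refl i≢i
    nonEdge 0F 1F _ i≁j = contradiction (inj₁ ≡.refl) i≁j
    nonEdge 1F 2F _ i≁j = contradiction (inj₁ ≡.refl) i≁j
    nonEdge 2F 3F _ i≁j = contradiction (inj₁ ≡.refl) i≁j
    nonEdge 3F 0F _ i≁j = contradiction (inj₁ ≡.refl) i≁j
    nonEdge 1F 0F _ i≁j = contradiction (inj₂ ≡.refl) i≁j
    nonEdge 2F 1F _ i≁j = contradiction (inj₂ ≡.refl) i≁j
    nonEdge 3F 2F _ i≁j = contradiction (inj₂ ≡.refl) i≁j
    nonEdge 0F 3F _ i≁j = contradiction (inj₂ ≡.refl) i≁j

    diagonal : ∀ i → L i i ≈ - sum (λ k → if does (k Fin.≟ i) then 0# else L i k)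
    diagonal 0F = solve 2 (λ a d → a :+ d := :- (:0 :+ (:- a :+ (:0 :+ (:- d :+ :0))))) refl a d
    diagonal 1F = solve 2 (λ a b → a :+ b := :- (:- a :+ (:0 :+ (:- b :+ (:0 :+ :0))))) refl a b
    diagonal 2F = solve 2 (λ b c → b :+ c := :- (:0 :+ (:- b :+ (:0 :+ (:- c :+ :0))))) refl b c
    diagonal 3F = solve 2 (λ c d → c :+ d := :- (:- d :+ (:0 :+ (:- c :+ (:0 :+ :0))))) refl c d

  -- Equal weights on opposite edges give y = z = 0, so the arrowhead matrix is diagonal. Here P = 4
  -- and Q = 2, and the nonzero eigenvalues are 2, 4, 6.
  attains-1111 : ∃[ A ] 𝒮ᴸ ℝ C₄ A × IsOrderedMultiplicityList ℝ A (1 ∷ 1 ∷ 1 ∷ 1 ∷ [])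
  attains-1111 = laplacian 1# 2# 1# 2# , laplacian∈𝒮ᴸ 0<1 0<2 0<1 0<2 ,
    laplacian-similar 1# 2# 1# 2# (λ _ _ → refl) (distinct⇒1111 (2# , 2# + 2# , 2# + 2# + 2# , 0<2 , x<x+2 , x<x+2 , roots
      (solve 0 (:2 :+ :2 :+ (:1 :+ :1) :+ (:2 :+ :2 :+ (:1 :+ :1)) := :2 :+ (:2 :+ :2) :+ (:2 :+ :2 :+ :2)) refl)
      (solve 0 ((:2 :+ :2) :* (:1 :+ :1) :+ (:2 :+ :2 :+ (:1 :+ :1)) :* (:2 :+ :2 :+ (:1 :+ :1))
          :- (:2 :- :2) :* (:2 :- :2) :- (:1 :- :1) :* (:1 :- :1)
        := :2 :* (:2 :+ :2) :+ :2 :* (:2 :+ :2 :+ :2) :+ (:2 :+ :2) :* (:2 :+ :2 :+ :2)) refl)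
      (solve 0 ((:2 :+ :2) :* (:1 :+ :1) :* (:2 :+ :2 :+ (:1 :+ :1))
          :- (:2 :- :2) :* (:2 :- :2) :* (:1 :+ :1) :- (:1 :- :1) :* (:1 :- :1) :* (:2 :+ :2)
        := :2 :* (:2 :+ :2) :* (:2 :+ :2 :+ :2)) refl)))
    where
    2# = 1# + 1#
    :2 : ∀ {n} → Polynomial n
    :2 = :1 :+ :1
    0<2 : 0# < 2#
    0<2 = +-pos 0<1 0<1
    x<x+2 : ∀ {x} → x < x + 2#
    x<x+2 {x} = 0<-⇒< (0<-resp (solve 1 (λ x → :2 := x :+ :2 :- x) refl x) 0<2)

  -- Unit weights give P = Q = 2 and y = z = 0, which is degenerate, with eigenvalues 0, 2, 2, 4.
  attains-121 : ∃[ A ] 𝒮ᴸ ℝ C₄ A × IsOrderedMultiplicityList ℝ A (1 ∷ 2 ∷ 1 ∷ [])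
  attains-121 = laplacian 1# 1# 1# 1# , laplacian∈𝒮ᴸ 0<1 0<1 0<1 0<1 ,
    laplacian-similar 1# 1# 1# 1# (λ _ _ → refl) (degenerate⇒121 0<2 0<2 (-‿inverseʳ 1# ,
      solve 0 ((:1 :- :1) :* (:1 :- :1) := (:1 :+ :1) :* (:1 :+ :1 :- (:1 :+ :1))) refl))
    where
    0<2 = +-pos 0<1 0<1

theorem3p7 : (ℝ : Reals) (ms : List ℕ) →
    (∃[ A ] 𝒮ᴸ ℝ C₄ A × IsOrderedMultiplicityList ℝ A ms)
      ⇔ (ms ≡ 1 ∷ 1 ∷ 1 ∷ 1 ∷ [] ⊎ ms ≡ 1 ∷ 2 ∷ 1 ∷ [])
theorem3p7 ℝ ms = mk⇔
  -- The given list and the one found by `classification` belong to the same matrix, so uniqueness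
  -- identifies them.
  (λ (_ , A∈𝒮ᴸ , O) → Sum.map (orderedMultiplicityList-unique O) (orderedMultiplicityList-unique O)
    (classification A∈𝒮ᴸ))
  Sum.[ (λ { ≡.refl → attains-1111 }) , (λ { ≡.refl → attains-121 }) ]′
  where
  open LinearAlgebra ℝ
  open FourCycle ℝ
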